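{- For every constant $0<\alpha\le 1$ there exists an integer $d_0\ge1$ such that the following holds for all $d\ge d_0$. Let $G$ be a bipartite graph with maximum degree $d$ and minimum degree at least $\alpha d$, and let $f(v)=\deg(v)-\left\lfloor \frac{\alpha}{1000}\sqrt{d\log d}\right\rfloor$ for each $v\in V(G)$. Then $G$ is $f$-removable.
   Context: All graphs are finite and simple; $\log$ is the natural logarithm. For a graph $G$, a function $f:V(G)\to\mathbb Z$, a vertex $u$ and $W\subseteq N(u)$, $\mathsf{DelSave}(G,f,u,W)$ outputs $G'=G-u$ and $f'$ with $f'(x)=f(x)-1$ for $x\in N(u)\setminus W$ and $f'(x)=f(x)$ otherwise; it is legal if $f(u)>\sum_{w\in W}f(w)$ and $f'(x)\ge1$ for all $x\in V(G')$. $G$ is $f$-removable if all vertices of $G$ can be deleted by successive legal $\mathsf{DelSave}$ applications, each time replacing $(G,f)$ by the output $(G',f')$. -}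

module Defs where

open import Data.Bool using (Bool; true; false; if_then_else_)
open import Data.Fin using (Fin; punchIn)
open import Data.Fin.Subset using (Subset; _⊆_; _─_; ∣_∣)
open import Data.Fin.Subset.Properties using (_∈?_)
open import Data.Integer as ℤ using (ℤ; +_)
import Data.Integer.Properties as ℤ
open import Data.Nat as ℕ using (ℕ; zero; suc; _!; _⊔_)
import Data.Nat.Properties as ℕ
open import Data.Product using (Σ-syntax; ∃-syntax; _×_; _,_)
open import Data.Rational as ℚ using (ℚ; 0ℚ; 1ℚ; ½)
import Data.Rational.Properties as ℚ
import Data.Rational.Solver as ℚ
open import Data.Vec using (tabulate)
open import Relation.Binary.PropositionalEquality
  using (_≡_; _≢_; refl; sym; trans; cong; subst)
open import Relation.Nullary.Decidable using (does)

open import Algebra.Properties.CommutativeMonoid.Sum ℤ.+-0-commutativeMonoid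
  using (sum)

record Graph (n : ℕ) : Set where
  field
    adj    : Fin n → Fin n → Bool
    symm   : ∀ u v → adj u v ≡ adj v u
    irrefl : ∀ v → adj v v ≡ false

open Graph public

N : ∀ {n} → Graph n → Fin n → Subset n
N G u = tabulate (adj G u)

deg : ∀ {n} → Graph n → Fin n → ℕ
deg G u = ∣ N G u ∣

Bipartite : ∀ {n} → Graph n → Set
Bipartite {n} G =
  Σ[ c ∈ (Fin n → Bool) ] (∀ u v → adj G u v ≡ true → c u ≢ c v)

IsMaxDegree : ∀ {n} → Graph n → ℕ → Set
IsMaxDegree G d = (∀ v → deg G v ℕ.≤ d) × (∃[ v ] deg G v ≡ d)

IsMinDegree : ∀ {n} → Graph n → ℕ → Set
IsMinDegree G δ = (∀ v → δ ℕ.≤ deg G v) × (∃[ v ] deg G v ≡ δ)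

-- The vertices of G - u are renumbered: vertex j of G - u is the vertex
-- punchIn u j of G, and punchIn u enumerates all vertices other than u.
_-ᵛ_ : ∀ {n} → Graph (suc n) → Fin (suc n) → Graph n
G -ᵛ u = record
  { adj    = λ i j → adj G (punchIn u i) (punchIn u j)
  ; symm   = λ i j → symm G (punchIn u i) (punchIn u j)
  ; irrefl = λ i → irrefl G (punchIn u i)
  }

-- The function f' output by DelSave (G, f, u, W); the graph output is G -ᵛ u.
delSave : ∀ {n} → Graph (suc n) → (Fin (suc n) → ℤ) →
          Fin (suc n) → Subset (suc n) → (Fin n → ℤ)
delSave G f u W j =
  let x = punchIn u j in
  if does (x ∈? (N G u ─ W)) then f x ℤ.- + 1 else f x

sumOver : ∀ {n} → Subset n → (Fin n → ℤ) → ℤ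
sumOver W f = sum (λ w → if does (w ∈? W) then f w else + 0)

Legal : ∀ {n} → Graph (suc n) → (Fin (suc n) → ℤ) →
        Fin (suc n) → Subset (suc n) → Set
Legal G f u W =
  f u ℤ.> sumOver W f × (∀ j → delSave G f u W j ℤ.≥ + 1)

data Removable : ∀ {n} → Graph n → (Fin n → ℤ) → Set where
  done : {G : Graph 0} {f : Fin 0 → ℤ} → Removable G f
  step : ∀ {n} {G : Graph (suc n)} {f : Fin (suc n) → ℤ}
         (u : Fin (suc n)) (W : Subset (suc n)) →
         W ⊆ N G u → Legal G f u W →
         Removable (G -ᵛ u) (delSave G f u W) →
         Removable G f

-- A Cauchy sequence of rationals; equality of reals is _≃ᴿ_ below, not _≡_.
record ℝ : Set where
  field
    seq    : ℕ → ℚ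
    cauchy : ∀ ε → 0ℚ ℚ.< ε →
             ∃[ k ] ∀ m n → k ℕ.≤ m → k ℕ.≤ n →
             ℚ.∣ seq m ℚ.- seq n ∣ ℚ.< ε

open ℝ public

infix 4 _≤ᴿ_ _<ᴿ_ _≃ᴿ_

_≤ᴿ_ : ℝ → ℝ → Set
x ≤ᴿ y = ∀ ε → 0ℚ ℚ.< ε →
         ∃[ k ] ∀ n → k ℕ.≤ n → seq x n ℚ.≤ seq y n ℚ.+ ε

_<ᴿ_ : ℝ → ℝ → Set
x <ᴿ y = ∃[ ε ] 0ℚ ℚ.< ε ×
         ∃[ k ] ∀ n → k ℕ.≤ n → seq x n ℚ.+ ε ℚ.≤ seq y n

_≃ᴿ_ : ℝ → ℝ → Set
x ≃ᴿ y = x ≤ᴿ y × y ≤ᴿ x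

fromℚ : ℚ → ℝ
fromℚ q = record
  { seq    = λ _ → q
  ; cauchy = λ ε ε>0 → 0 , λ _ _ _ _ →
      subst (ℚ._< ε) (sym (cong ℚ.∣_∣ (ℚ.+-inverseʳ q))) ε>0
  }

fromℤ : ℤ → ℝ
fromℤ z = fromℚ (z ℚ./ 1)

fromℕ : ℕ → ℝ
fromℕ n = fromℤ (+ n)

private
  half : ℚ → ℚ
  half ε = ½ ℚ.* ε

  half>0 : ∀ {ε} → 0ℚ ℚ.< ε → 0ℚ ℚ.< half ε
  half>0 {ε} ε>0 = subst (ℚ._< half ε) (ℚ.*-zeroʳ ½) (ℚ.*-monoʳ-<-pos ½ ε>0)

  half+half : ∀ ε → half ε ℚ.+ half ε ≡ ε
  half+half ε = trans (sym (ℚ.*-distribʳ-+ ε ½ ½)) (ℚ.*-identityˡ ε)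

infixl 6 _+ᴿ_
infixl 7 _*ᴿ_

_+ᴿ_ : ℝ → ℝ → ℝ
x +ᴿ y = record
  { seq    = λ n → seq x n ℚ.+ seq y n
  ; cauchy = λ ε ε>0 →
      let k , p = cauchy x (half ε) (half>0 ε>0)
          l , q = cauchy y (half ε) (half>0 ε>0)
      in k ⊔ l , λ m n m≥ n≥ → begin-strict
        ℚ.∣ (seq x m ℚ.+ seq y m) ℚ.- (seq x n ℚ.+ seq y n) ∣
          ≡⟨ cong ℚ.∣_∣ (rearrange (seq x m) (seq y m) (seq x n) (seq y n)) ⟩
        ℚ.∣ (seq x m ℚ.- seq x n) ℚ.+ (seq y m ℚ.- seq y n) ∣
          ≤⟨ ℚ.∣p+q∣≤∣p∣+∣q∣ (seq x m ℚ.- seq x n) (seq y m ℚ.- seq y n) ⟩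
        ℚ.∣ seq x m ℚ.- seq x n ∣ ℚ.+ ℚ.∣ seq y m ℚ.- seq y n ∣
          <⟨ ℚ.+-mono-< (p m n (ℕ.m⊔n≤o⇒m≤o k l m≥) (ℕ.m⊔n≤o⇒m≤o k l n≥))
                        (q m n (ℕ.m⊔n≤o⇒n≤o k l m≥) (ℕ.m⊔n≤o⇒n≤o k l n≥)) ⟩
        half ε ℚ.+ half ε
          ≡⟨ half+half ε ⟩
        ε ∎
  }
  where
  open ℚ.≤-Reasoning
  open ℚ.+-*-Solver
  rearrange : ∀ a b c d →
              (a ℚ.+ b) ℚ.- (c ℚ.+ d) ≡ (a ℚ.- c) ℚ.+ (b ℚ.- d)
  rearrange = solve 4 (λ a b c d →
    (a :+ b) :- (c :+ d) := (a :- c) :+ (b :- d)) refl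

private
  eventuallyBounded : (x : ℝ) →
    ∃[ B ] 0ℚ ℚ.< B × ∃[ k ] ∀ n → k ℕ.≤ n → ℚ.∣ seq x n ∣ ℚ.≤ B
  eventuallyBounded x =
    let k , p = cauchy x 1ℚ (ℚ.positive⁻¹ 1ℚ)
        a     = seq x k
    in ℚ.∣ a ∣ ℚ.+ 1ℚ
     , ℚ.+-mono-≤-< (ℚ.0≤∣p∣ a) (ℚ.positive⁻¹ 1ℚ)
     , k , λ n n≥ → begin
        ℚ.∣ seq x n ∣                    ≡⟨ cong ℚ.∣_∣ (split a (seq x n)) ⟩
        ℚ.∣ a ℚ.+ (seq x n ℚ.- a) ∣       ≤⟨ ℚ.∣p+q∣≤∣p∣+∣q∣ a (seq x n ℚ.- a) ⟩
        ℚ.∣ a ∣ ℚ.+ ℚ.∣ seq x n ℚ.- a ∣    ≤⟨ ℚ.+-monoʳ-≤ ℚ.∣ a ∣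
                                             (ℚ.<⇒≤ (p n k n≥ ℕ.≤-refl)) ⟩
        ℚ.∣ a ∣ ℚ.+ 1ℚ                   ∎
    where
    open ℚ.≤-Reasoning
    open ℚ.+-*-Solver
    split : ∀ a b → b ≡ a ℚ.+ (b ℚ.- a)
    split = solve 2 (λ a b → b := a :+ (b :- a)) refl

  splitPos : ∀ {B ε} → 0ℚ ℚ.< B → 0ℚ ℚ.< ε →
             ∃[ δ ] 0ℚ ℚ.< δ × B ℚ.* δ ≡ ε
  splitPos {B} {ε} B>0 ε>0 =
    (ℚ.1/ B) ℚ.* ε
    , ℚ.positive⁻¹ _ ⦃ ℚ.pos*pos⇒pos (ℚ.1/ B) ⦃ ℚ.1/pos⇒pos B ⦄ ε ⦄
    , trans (sym (ℚ.*-assoc B (ℚ.1/ B) ε))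
      (trans (cong (ℚ._* ε) (ℚ.*-inverseʳ B)) (ℚ.*-identityˡ ε))
    where
    instance
      _ : ℚ.Positive B
      _ = ℚ.positive B>0
      _ : ℚ.Positive ε
      _ = ℚ.positive ε>0
      _ : ℚ.NonZero B
      _ = ℚ.pos⇒nonZero B

  *-bound : ∀ {a B b δ} → 0ℚ ℚ.< B → ℚ.∣ a ∣ ℚ.≤ B → ℚ.∣ b ∣ ℚ.< δ →
            ℚ.∣ a ℚ.* b ∣ ℚ.< B ℚ.* δ
  *-bound {a} {B} {b} {δ} B>0 a≤ b< = begin-strict
    ℚ.∣ a ℚ.* b ∣          ≡⟨ ℚ.∣p*q∣≡∣p∣*∣q∣ a b ⟩
    ℚ.∣ a ∣ ℚ.* ℚ.∣ b ∣     ≤⟨ ℚ.*-monoʳ-≤-nonNeg ℚ.∣ b ∣ ⦃ ℚ.∣-∣-nonNeg b ⦄ a≤ ⟩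
    B ℚ.* ℚ.∣ b ∣          <⟨ ℚ.*-monoʳ-<-pos B ⦃ ℚ.positive B>0 ⦄ b< ⟩
    B ℚ.* δ               ∎
    where open ℚ.≤-Reasoning

_*ᴿ_ : ℝ → ℝ → ℝ
x *ᴿ y = record
  { seq    = λ n → seq x n ℚ.* seq y n
  ; cauchy = λ ε ε>0 →
      let B , B>0 , i , x≤ = eventuallyBounded x
          C , C>0 , j , y≤ = eventuallyBounded y
          δ , δ>0 , eq     = splitPos (ℚ.+-mono-< B>0 C>0) ε>0
          k , p            = cauchy x δ δ>0
          l , q            = cauchy y δ δ>0
      in (i ⊔ j) ⊔ (k ⊔ l) , λ m n m≥ n≥ →
        let m≥ij = ℕ.m⊔n≤o⇒m≤o (i ⊔ j) (k ⊔ l) m≥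
            n≥ij = ℕ.m⊔n≤o⇒m≤o (i ⊔ j) (k ⊔ l) n≥
            m≥kl = ℕ.m⊔n≤o⇒n≤o (i ⊔ j) (k ⊔ l) m≥
            n≥kl = ℕ.m⊔n≤o⇒n≤o (i ⊔ j) (k ⊔ l) n≥
            a = seq x m ; b = seq y m ; c = seq x n ; d = seq y n
        in begin-strict
          ℚ.∣ a ℚ.* b ℚ.- c ℚ.* d ∣
            ≡⟨ cong ℚ.∣_∣ (rearrange a b c d) ⟩
          ℚ.∣ a ℚ.* (b ℚ.- d) ℚ.+ d ℚ.* (a ℚ.- c) ∣
            ≤⟨ ℚ.∣p+q∣≤∣p∣+∣q∣ (a ℚ.* (b ℚ.- d)) (d ℚ.* (a ℚ.- c)) ⟩
          ℚ.∣ a ℚ.* (b ℚ.- d) ∣ ℚ.+ ℚ.∣ d ℚ.* (a ℚ.- c) ∣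
            <⟨ ℚ.+-mono-<
                 (*-bound B>0 (x≤ m (ℕ.m⊔n≤o⇒m≤o i j m≥ij))
                   (q m n (ℕ.m⊔n≤o⇒n≤o k l m≥kl) (ℕ.m⊔n≤o⇒n≤o k l n≥kl)))
                 (*-bound C>0 (y≤ n (ℕ.m⊔n≤o⇒n≤o i j n≥ij))
                   (p m n (ℕ.m⊔n≤o⇒m≤o k l m≥kl) (ℕ.m⊔n≤o⇒m≤o k l n≥kl))) ⟩
          B ℚ.* δ ℚ.+ C ℚ.* δ
            ≡⟨ sym (ℚ.*-distribʳ-+ δ B C) ⟩
          (B ℚ.+ C) ℚ.* δ
            ≡⟨ eq ⟩
          ε ∎
  }
  where
  open ℚ.≤-Reasoning
  open ℚ.+-*-Solver
  rearrange : ∀ a b c d →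
              a ℚ.* b ℚ.- c ℚ.* d ≡ a ℚ.* (b ℚ.- d) ℚ.+ d ℚ.* (a ℚ.- c)
  rearrange = solve 4 (λ a b c d →
    a :* b :- c :* d := a :* (b :- d) :+ d :* (a :- c)) refl

_^ᴿ_ : ℝ → ℕ → ℝ
x ^ᴿ zero  = fromℕ 1
x ^ᴿ suc n = x *ᴿ (x ^ᴿ n)

infix 4 _⟶_

_⟶_ : (ℕ → ℝ) → ℝ → Set
s ⟶ L = ∀ ε → 0ℚ ℚ.< ε → ∃[ k ] ∀ n → k ℕ.≤ n →
        s n ≤ᴿ L +ᴿ fromℚ ε × L ≤ᴿ s n +ᴿ fromℚ ε

invFactorial : ℕ → ℚ
invFactorial n = (+ 1) ℚ./ (n !)
  where instance _ = n ℕ.!≢0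

expSum : ℝ → ℕ → ℝ
expSum x zero    = fromℕ 0
expSum x (suc n) = expSum x n +ᴿ (x ^ᴿ n) *ᴿ fromℚ (invFactorial n)

-- Relations rather than functions, since the floor is not computable on ℝ:
-- IsExp x y reads exp x = y, IsLog y x reads log y = x, IsSqrt y x reads
-- √ y = x and IsFloor x k reads ⌊ x ⌋ = k.
IsExp : ℝ → ℝ → Set
IsExp x y = expSum x ⟶ y

IsLog : ℝ → ℝ → Set
IsLog y x = IsExp x y

IsSqrt : ℝ → ℝ → Set
IsSqrt y x = fromℕ 0 ≤ᴿ x × x *ᴿ x ≃ᴿ y

IsFloor : ℝ → ℤ → Set
IsFloor x k = fromℤ k ≤ᴿ x × x <ᴿ fromℤ (k ℤ.+ + 1)

module Submission where

-- Let A and B be the two sides and t = ⌊(α / 1000) √(d log d)⌋.  Pick a sparse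
-- set of late vertices such that every vertex has more than t late neighbours,
-- and delete the early vertices of B, then the early vertices of A, then the
-- late vertices of B and finally the late vertices of A.  All vertices but the
-- last have more than t neighbours deleted after them, so they need no saving.
--
-- A late vertex w of A loses all its neighbours, so it must be saved more than
-- t times.  An early u in B still has f(u) ≥ deg(u) / 2 when it is deleted,
-- whereas f(w) has dropped to at most the number of remaining neighbours of w
-- (once it exceeds that number, w is safe for good).  Hence, when a fraction y
-- of B is left, u can pay for a number of late neighbours proportional to 1 / y,
-- and every dyadic range of y contributes equally to the total: this is where
-- the factor log d comes from.  To share the savings evenly, w carries a random
-- scale i and a residue modulo 2^i, which single out a fraction 2^(-i) of the
-- vertices of B deleted while 2^i / M ≤ y < 2^(i+1) / M, where 1 / M is the
-- proportion of late vertices.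
--
-- The vertices receive random labels that encode all these choices.  Chernoff
-- bounds and the local lemma yield labels for which every neighbourhood
-- contains each label about as often as expected; the rest is deterministic.

open import Defs
open import Algebra.Properties.CommutativeMonoid.Sum as CommutativeMonoidSum using ()
open import Algebra.Properties.Semiring.Sum as SemiringSum using ()
open import Data.Bool using (Bool; true; false; not; _∧_; if_then_else_)
open import Data.Bool.Properties using (T-≡; ∧-zeroʳ)
open import Data.Fin using (Fin; zero; suc; punchIn; toℕ; fromℕ<)
import Data.Fin.Properties as Finₚ
open import Data.Fin.Subset using (Subset; _⊆_; _─_; ∣_∣)
open import Data.Fin.Subset.Properties using (_∈?_)
open import Data.Integer as ℤ using (ℤ; +_; -[1+_]; _-_)
import Data.Integer.Properties as ℤₚ
open import Data.List using (List; []; _∷_; _++_; length; filterᵇ; allFin)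
import Data.List as List
open import Data.List.Membership.Propositional using (_∈_)
open import Data.List.Membership.Propositional.Properties using (∈-allFin)
open import Data.List.Relation.Unary.All as All using (All; []; _∷_)
open import Data.List.Relation.Unary.Any using (here; there)
open import Data.Nat as ℕ hiding (_/_; _%_)
open import Data.Nat.DivMod hiding (_/_; _%_)
open import Data.Nat.Properties as ℕₚ
open import Data.Nat.Tactic.RingSolver using (solve-∀)
open import Data.Product using (Σ-syntax; ∃-syntax; _×_; _,_; proj₁; proj₂)
open import Data.Rational as ℚ using (ℚ; 0ℚ; 1ℚ; _/_; mkℚ)
import Data.Rational.Properties as ℚₚ
import Data.Rational.Solver as ℚSolver
open import Data.Rational.Unnormalised as ℚᵘ using (mkℚᵘ; *≤*; *≡*)
import Data.Rational.Unnormalised.Properties as ℚᵘₚ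
open import Data.Sum using (_⊎_; inj₁; inj₂)
open import Data.Vec using (Vec; []; _∷_; lookup; tabulate)
open import Data.Vec.Properties using (lookup∘tabulate; lookup⇒[]=; []=⇒lookup)
open import Function using (_∘_; it; Equivalence)
open import Relation.Binary.PropositionalEquality hiding (J)
open import Relation.Nullary using (¬_; yes; no; does; contradiction)

open SemiringSum +-*-semiring
open CommutativeMonoidSum ℤₚ.+-0-commutativeMonoid using () renaming (sum to sumℤ)

-- Deletion plans

⟦_⟧ : Bool → ℕ
⟦ b ⟧ = if b then 1 else 0

count : ∀ {n} → (Fin n → Bool) → ℕ
count p = sum (λ i → ⟦ p i ⟧)

sum-mono : ∀ {n} {f g : Fin n → ℕ} → (∀ i → f i ≤ g i) → sum f ≤ sum g
sum-mono {zero}  f≤g = z≤n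
sum-mono {suc n} f≤g = +-mono-≤ (f≤g zero) (sum-mono (f≤g ∘ suc))

⟦⟧-mono : ∀ {a b} → (a ≡ true → b ≡ true) → ⟦ a ⟧ ≤ ⟦ b ⟧
⟦⟧-mono {false}     _ = z≤n
⟦⟧-mono {true}  a⇒b rewrite a⇒b refl = ≤-refl

count-mono : ∀ {n} (p q : Fin n → Bool) → (∀ i → p i ≡ true → q i ≡ true) → count p ≤ count q
count-mono p q p⇒q = sum-mono {f = λ i → ⟦ p i ⟧} {g = λ i → ⟦ q i ⟧} λ i → ⟦⟧-mono {p i} {q i} (p⇒q i)

sum-at : ∀ {n} (f : Fin (suc n) → ℕ) u → sum f ≡ f u + sum (f ∘ punchIn u)
sum-at f u = sum-remove {i = u} f

≤⇒≤ᵇ≡ : ∀ {m n} → m ≤ n → (m ≤ᵇ n) ≡ true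
≤⇒≤ᵇ≡ m≤n = Equivalence.to T-≡ (≤⇒≤ᵇ m≤n)

≤ᵇ≡⇒≤ : ∀ {m n} → (m ≤ᵇ n) ≡ true → m ≤ n
≤ᵇ≡⇒≤ {m} {n} eq = ≤ᵇ⇒≤ m n (Equivalence.from T-≡ eq)

∧-elim : ∀ {a b} → a ∧ b ≡ true → a ≡ true × b ≡ true
∧-elim {true} eq = refl , eq

∧-intro : ∀ {a b} → a ≡ true → b ≡ true → a ∧ b ≡ true
∧-intro refl eq = eq

count≡∣tabulate∣ : ∀ {n} (p : Fin n → Bool) → ∣ tabulate p ∣ ≡ count p
count≡∣tabulate∣ {zero}  p = refl
count≡∣tabulate∣ {suc n} p with p zero
... | true  = cong suc (count≡∣tabulate∣ (p ∘ suc))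
... | false = count≡∣tabulate∣ (p ∘ suc)

does-∈ : ∀ {n} (x : Fin n) (S : Subset n) → does (x ∈? S) ≡ lookup S x
does-∈ zero    (true ∷ S)  = refl
does-∈ zero    (false ∷ S) = refl
does-∈ (suc x) (s ∷ S)     = does-∈ x S

lookup-─ : ∀ {n} (x : Fin n) (S R : Subset n) →
           lookup (S ─ R) x ≡ lookup S x ∧ not (lookup R x)
lookup-─ zero (s ∷ S) (true ∷ R) = sym (∧-zeroʳ s)
lookup-─ zero (true ∷ S) (false ∷ R) = refl
lookup-─ zero (false ∷ S) (false ∷ R) = refl
lookup-─ (suc x) (s ∷ S) (r ∷ R) = lookup-─ x S R

sumℤ≤ : ∀ {n} {f : Fin n → ℤ} {g : Fin n → ℕ} →
        (∀ i → f i ℤ.≤ + g i) → sumℤ f ℤ.≤ + sum g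
sumℤ≤ {zero}  f≤g = ℤₚ.≤-refl
sumℤ≤ {suc n} f≤g = ℤₚ.+-mono-≤ (f≤g zero) (sumℤ≤ (f≤g ∘ suc))

argmin : ∀ {n} (r : Fin (suc n) → ℕ) → ∃[ u ] ∀ v → r u ≤ r v
argmin {zero} r = zero , λ { zero → ≤-refl }
argmin {suc n} r with argmin (r ∘ suc)
... | u , min with ≤-total (r zero) (r (suc u))
...   | inj₁ le = zero , λ { zero → ≤-refl ; (suc v) → ≤-trans le (min v) }
...   | inj₂ le = suc u , λ { zero → le ; (suc v) → min v }

module _ {n} (G : Graph n) (rank : Fin n → ℕ) where

  -- Vertices of equal rank count as earlier here and as in between below, so that the bounds hold
  -- however ties are broken.
  isEarlier : Fin n → Fin n → Bool
  isEarlier v w = adj G v w ∧ (rank w ≤ᵇ rank v)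

  isBetween : Fin n → Fin n → Fin n → Bool
  isBetween u w x = adj G w x ∧ (rank u ≤ᵇ rank x) ∧ (rank x ≤ᵇ rank w)

  earlier : Fin n → ℕ
  earlier v = count (isEarlier v)

  between : Fin n → Fin n → ℕ
  between u w = count (isBetween u w)

  module _ (cand : Fin n → Fin n → Bool) where

    isUnsaved : Fin n → Fin n → Bool
    isUnsaved v w = adj G v w ∧ (rank w ≤ᵇ rank v) ∧ not (cand w v)

    unsaved : Fin n → ℕ
    unsaved v = count (isUnsaved v)

    -- Worst-case price of saving all candidates of u: each w is charged for its neighbours that are
    -- deleted from u on and no later than w.
    load : Fin n → ℕ
    load u = sum λ w → ⟦ cand u w ⟧ * between u w

-- Vertices are to be deleted by increasing rank (ties broken arbitrarily), and
-- the deletion of u may save only the w with cand u w.  Both inequalities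
-- survive such a deletion.
record Plan {n} (G : Graph n) (f : Fin n → ℤ) (rank : Fin n → ℕ)
            (cand : Fin n → Fin n → Bool) : Set where
  field
    cand⇒adj : ∀ u w → cand u w ≡ true → adj G u w ≡ true
    enough   : ∀ v → + suc (unsaved G rank cand v) ℤ.≤ f v
    payable  : ∀ u → (∀ w → cand u w ≡ false) ⊎
               + suc (earlier G rank u + load G rank cand u) ℤ.≤ f u

open Plan

-- Induction on the number of vertices: a vertex u of least rank is deleted, and W consists of the
-- candidates w of u with `f w` at most `earlier G rank w`. A candidate above this threshold stays
-- positive even if it is never saved again, so nothing is paid for it.
plan⇒removable : ∀ {n} {G : Graph n} {f rank cand} →
                 Plan G f rank cand → Removable G f
plan⇒removable {zero}  P = done
plan⇒removable {suc n} {G} {f} {rank} {cand} P =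
  step u W W⊆N (pays , positive) (plan⇒removable P′)
  where
  u = proj₁ (argmin rank)
  u-min = proj₂ (argmin rank)
  p : Fin (suc n) → Bool
  p w = cand u w ∧ does (f w ℤₚ.≤? + earlier G rank w)
  W = tabulate p
  f′ = delSave G f u W
  rank′ = rank ∘ punchIn u
  cand′ : Fin n → Fin n → Bool
  cand′ i j = cand (punchIn u i) (punchIn u j)

  ∈W : ∀ w → does (w ∈? W) ≡ p w
  ∈W w = trans (does-∈ w W) (lookup∘tabulate p w)

  W⊆N : W ⊆ N G u
  W⊆N {w} w∈W = lookup⇒[]= w (N G u) (trans (lookup∘tabulate (adj G u) w)
    (cand⇒adj P u w (proj₁ (∧-elim
      (trans (sym (lookup∘tabulate p w)) ([]=⇒lookup w∈W))))))

  f′-eq : ∀ j → f′ j ≡ (if adj G (punchIn u j) u ∧ not (p (punchIn u j))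
                        then f (punchIn u j) ℤ.- + 1 else f (punchIn u j))
  f′-eq j = cong (if_then f x ℤ.- + 1 else f x) (begin
    does (x ∈? (N G u ─ W))           ≡⟨ does-∈ x (N G u ─ W) ⟩
    lookup (N G u ─ W) x              ≡⟨ lookup-─ x (N G u) W ⟩
    lookup (N G u) x ∧ not (lookup W x)
      ≡⟨ cong₂ (λ a b → a ∧ not b) (lookup∘tabulate (adj G u) x) (lookup∘tabulate p x) ⟩
    adj G u x ∧ not (p x)             ≡⟨ cong (_∧ not (p x)) (symm G u x) ⟩
    adj G x u ∧ not (p x)             ∎)
    where
    open ≡-Reasoning
    x = punchIn u j

  -- No vertex of the current graph has smaller rank than u, so restricting to ranks from u on loses
  -- nothing.
  earlier≤between : ∀ w → earlier G rank w ≤ between G rank u w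
  earlier≤between w = count-mono (isEarlier G rank w) (isBetween G rank u w) λ x eq →
    let a , b = ∧-elim {adj G w x} eq in ∧-intro a (∧-intro (≤⇒≤ᵇ≡ (u-min x)) b)

  pays : sumOver W f ℤ.< f u
  pays with payable P u
  ... | inj₁ none = ℤₚ.<-≤-trans (ℤₚ.≤-<-trans
          (sumℤ≤ {g = λ _ → 0} zeros) (ℤ.+<+ (s≤s (≤-reflexive (sum-replicate-zero (suc n))))))
          (ℤₚ.≤-trans (ℤ.+≤+ (s≤s z≤n)) (enough P u))
    where
    zeros : ∀ w → (if does (w ∈? W) then f w else + 0) ℤ.≤ + 0
    zeros w rewrite ∈W w | none w = ℤₚ.≤-refl
  ... | inj₂ ok = ℤₚ.<-≤-trans (ℤₚ.≤-<-trans (sumℤ≤ costs)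
          (ℤ.+<+ (s≤s (m≤n+m _ (earlier G rank u))))) ok
    where
    costs : ∀ w → (if does (w ∈? W) then f w else + 0) ℤ.≤
            + (⟦ cand u w ⟧ * between G rank u w)
    costs w rewrite ∈W w with cand u w
    ... | false = ℤₚ.≤-refl
    ... | true with f w ℤₚ.≤? + earlier G rank w
    ...   | yes le = ℤₚ.≤-trans le (ℤ.+≤+ (≤-trans (earlier≤between w) (m≤m+n _ 0)))
    ...   | no _   = ℤ.+≤+ z≤n

  pred-≤ : ∀ {m z} → + suc m ℤ.≤ z → + m ℤ.≤ z ℤ.- + 1
  pred-≤ {m} {z} le = ℤₚ.≤-trans (ℤₚ.≤-reflexive (sym (ℤₚ.pred-suc (+ m))))
    (ℤₚ.≤-trans (ℤₚ.pred-mono le) (ℤₚ.≤-reflexive (ℤₚ.+-comm (ℤ.- + 1) z)))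

  cut : ∀ b {m z} → + suc m ℤ.≤ z → + m ℤ.≤ (if b then z ℤ.- + 1 else z)
  cut true  le = pred-≤ le
  cut false le = ℤₚ.≤-trans (ℤ.+≤+ (n≤1+n _)) le

  unsaved′≤earlier′ : ∀ j → unsaved (G -ᵛ u) rank′ cand′ j ≤ earlier (G -ᵛ u) rank′ j
  unsaved′≤earlier′ j = count-mono (isUnsaved (G -ᵛ u) rank′ cand′ j) (isEarlier (G -ᵛ u) rank′ j)
    λ w eq → let a , b = ∧-elim {adj (G -ᵛ u) j w} eq in ∧-intro a (proj₁ (∧-elim b))

  -- Three cases for a neighbour of u. A non-candidate loses 1, but u leaves its unsaved count. A
  -- saved candidate loses nothing. A candidate left out of W has f above `earlier`; both drop by 1,
  -- and `earlier` bounds the unsaved count.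
  enough′ : ∀ j → + suc (unsaved (G -ᵛ u) rank′ cand′ j) ℤ.≤ f′ j
  enough′ j with enough P (punchIn u j)
  ... | en rewrite f′-eq j
    | sum-at (λ w → ⟦ adj G (punchIn u j) w ∧ (rank w ≤ᵇ rank (punchIn u j)) ∧ not (cand w (punchIn u j)) ⟧) u
    | ≤⇒≤ᵇ≡ (u-min (punchIn u j))
    with adj G (punchIn u j) u in adj-eq
  ...   | false = en
  ...   | true with cand u (punchIn u j)
  ...     | false = pred-≤ en
  ...     | true with f (punchIn u j) ℤₚ.≤? + earlier G rank (punchIn u j)
  ...       | yes _ = en
  ...       | no gt = pred-≤ (ℤₚ.≤-trans
                (ℤ.+≤+ (s≤s (≤-trans (s≤s (unsaved′≤earlier′ j)) (≤-reflexive (sym earlier-eq)))))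
                (ℤₚ.i<j⇒suc[i]≤j (ℤₚ.≰⇒> gt)))
    where
    earlier-eq : earlier G rank (punchIn u j) ≡ suc (earlier (G -ᵛ u) rank′ j)
    earlier-eq = trans (sum-at (λ w → ⟦ isEarlier G rank (punchIn u j) w ⟧) u)
      (cong (λ b → ⟦ b ⟧ + earlier (G -ᵛ u) rank′ j)
        (∧-intro adj-eq (≤⇒≤ᵇ≡ (u-min (punchIn u j)))))

  positive : ∀ j → + 1 ℤ.≤ f′ j
  positive j = ℤₚ.≤-trans (ℤ.+≤+ (s≤s z≤n)) (enough′ j)

  between′≤ : ∀ i j → between (G -ᵛ u) rank′ i j ≤ between G rank (punchIn u i) (punchIn u j)
  between′≤ i j = ≤-trans (m≤n+m _ ⟦ isBetween G rank x y u ⟧)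
    (≤-reflexive (sym (sum-at (λ w → ⟦ isBetween G rank x y w ⟧) u)))
    where
    x = punchIn u i
    y = punchIn u j

  load′≤ : ∀ j → load (G -ᵛ u) rank′ cand′ j ≤ load G rank cand (punchIn u j)
  load′≤ j = ≤-trans (sum-mono {g = term ∘ punchIn u} λ w → *-monoʳ-≤ ⟦ cand′ j w ⟧ (between′≤ j w))
    (≤-trans (m≤n+m _ (term u)) (≤-reflexive (sym (sum-at term u))))
    where
    term : Fin (suc n) → ℕ
    term w = ⟦ cand (punchIn u j) w ⟧ * between G rank (punchIn u j) w

  -- A neighbour of u loses at most 1, which is offset by u leaving its `earlier` count; the load
  -- never grows.
  payable′ : ∀ j → (∀ w → cand′ j w ≡ false) ⊎
             + suc (earlier (G -ᵛ u) rank′ j + load (G -ᵛ u) rank′ cand′ j) ℤ.≤ f′ j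
  payable′ j with payable P (punchIn u j)
  ... | inj₁ none = inj₁ (none ∘ punchIn u)
  ... | inj₂ ok rewrite f′-eq j
    | sum-at (λ w → ⟦ adj G (punchIn u j) w ∧ (rank w ≤ᵇ rank (punchIn u j)) ⟧) u
    | ≤⇒≤ᵇ≡ (u-min (punchIn u j))
    with adj G (punchIn u j) u
  ...   | false = inj₂ (ℤₚ.≤-trans (ℤ.+≤+ (s≤s (+-monoʳ-≤ _ (load′≤ j)))) ok)
  ...   | true  = inj₂ (cut (not _) (ℤₚ.≤-trans (ℤ.+≤+ (s≤s (s≤s (+-monoʳ-≤ _ (load′≤ j))))) ok))

  P′ : Plan (G -ᵛ u) f′ rank′ cand′
  P′ = record
    { cand⇒adj = λ i j → cand⇒adj P (punchIn u i) (punchIn u j)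
    ; enough   = enough′
    ; payable  = payable′
    }

-- Random labellings and the local lemma

sum-* : ∀ {n} (f : Fin n → ℕ) x → sum f * x ≡ sum (λ i → f i * x)
sum-* f x = *-distribʳ-sum x f

sum-const : ∀ n x → sum {n} (λ _ → x) ≡ n * x
sum-const zero    x = refl
sum-const (suc n) x = cong (λ y → x + y) (sum-const n x)

sum>0 : ∀ {n} {f : Fin n → ℕ} → 0 < sum f → ∃[ i ] 0 < f i
sum>0 {suc n} {f} pos with f zero in eq
... | suc _ = zero , subst (0 <_) (sym eq) (s≤s z≤n)
... | zero  = let i , p = sum>0 {n} {f ∘ suc} pos in suc i , p

module _ {K : ℕ} where

  -- Unnormalised expectation over a uniformly random labelling.
  E : ∀ n → (Vec (Fin K) n → ℕ) → ℕ
  E zero    F = F []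
  E (suc n) F = sum λ k → E n (λ c → F (k ∷ c))

  E-mono : ∀ n {F H} → (∀ c → F c ≤ H c) → E n F ≤ E n H
  E-mono zero    F≤H = F≤H []
  E-mono (suc n) F≤H = sum-mono λ k → E-mono n (λ c → F≤H (k ∷ c))

  E-cong : ∀ n {F H} → (∀ c → F c ≡ H c) → E n F ≡ E n H
  E-cong zero    F≡H = F≡H []
  E-cong (suc n) F≡H = sum-cong-≗ λ k → E-cong n (λ c → F≡H (k ∷ c))

  E-+ : ∀ n F H → E n (λ c → F c + H c) ≡ E n F + E n H
  E-+ zero    F H = refl
  E-+ (suc n) F H = trans (sum-cong-≗ λ k → E-+ n (λ c → F (k ∷ c)) (λ c → H (k ∷ c)))
    (∑-distrib-+ (λ k → E n (λ c → F (k ∷ c))) (λ k → E n (λ c → H (k ∷ c))))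

  E-* : ∀ n x F → E n (λ c → x * F c) ≡ x * E n F
  E-* zero    x F = refl
  E-* (suc n) x F = trans (sum-cong-≗ λ k → E-* n x (λ c → F (k ∷ c)))
    (sym (*-distribˡ-sum x (λ k → E n (λ c → F (k ∷ c)))))

  E-sum : ∀ n {l} (F : Fin l → Vec (Fin K) n → ℕ) →
          E n (λ c → sum (λ i → F i c)) ≡ sum (λ i → E n (F i))
  E-sum zero    F = refl
  E-sum (suc n) F = trans (sum-cong-≗ λ k → E-sum n (λ i c → F i (k ∷ c)))
    (∑-comm (λ k i → E n (λ c → F i (k ∷ c))))

  E>0 : ∀ n {F} → 0 < E n F → ∃[ c ] 0 < F c
  E>0 zero    pos = [] , pos
  E>0 (suc n) pos = let k , p = sum>0 pos ; c , q = E>0 n p in k ∷ c , q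

  E1>0 : ∀ n → .{{NonZero K}} → 0 < E n (λ _ → 1)
  E1>0 zero    = s≤s z≤n
  E1>0 (suc n) = subst (0 <_) (sym (sum-const K _)) (*-mono-< (>-nonZero⁻¹ K) (E1>0 n))

  -- For a uniform labelling this product over S has independent factors; suitable γ turn it into
  -- the exponential moments of the Chernoff bounds.
  weight : ∀ {n} → (Fin n → Bool) → (Fin K → ℕ) → Vec (Fin K) n → ℕ
  weight S γ []      = 1
  weight S γ (k ∷ c) = (if S zero then γ k else 1) * weight (S ∘ suc) γ c

  IndependentOf : ∀ {n} → (Fin n → Bool) → (Vec (Fin K) n → ℕ) → Set
  IndependentOf S H = ∀ c c′ → (∀ i → S i ≡ false → lookup c i ≡ lookup c′ i) → H c ≡ H c′

-- Induction over the coordinates: one in S splits off a factor `sum γ` because H ignores it, and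
-- one outside S is merely summed over. Thus the weight is independent of H and has mean (`sum γ` /
-- K) ^ `count S`. K is a successor so that the label `zero` can stand in for an ignored coordinate.
factor : ∀ {K-1} (let K = suc K-1) n (S : Fin n → Bool) (γ : Fin K → ℕ) H → IndependentOf S H →
         E n (λ c → weight S γ c * H c) * K ^ count S ≡ sum γ ^ count S * E n H
factor zero S γ H ind = trans (*-identityʳ _) refl
factor {K-1} (suc n) S γ H ind with S zero in S0
... | true = begin
    sum (λ k → E n (λ c → γ k * w c * H (k ∷ c))) * (K * K ^ s)
      ≡⟨ cong (_* (K * K ^ s)) (trans (sum-cong-≗ inner) (sym (sum-* γ Z))) ⟩
    sum γ * Z * (K * K ^ s)          ≡⟨ r₁ (sum γ) Z K (K ^ s) ⟩
    sum γ * K * (Z * K ^ s)          ≡⟨ cong (sum γ * K *_) (factor n S′ γ H₀ ind₀) ⟩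
    sum γ * K * (sum γ ^ s * E n H₀) ≡⟨ r₂ (sum γ) K (sum γ ^ s) (E n H₀) ⟩
    sum γ * sum γ ^ s * (K * E n H₀) ≡⟨ cong (sum γ * sum γ ^ s *_) (sym EH) ⟩
    sum γ * sum γ ^ s * E (suc n) H  ∎
    where
    open ≡-Reasoning
    K = suc K-1
    S′ = S ∘ suc
    s = count S′
    w = weight S′ γ
    H₀ : Vec (Fin K) n → ℕ
    H₀ c = H (zero ∷ c)
    Z = E n (λ c → w c * H₀ c)
    H-const : ∀ k c → H (k ∷ c) ≡ H₀ c
    H-const k c = ind _ _ λ { zero f → contradiction (trans (sym S0) f) λ () ; (suc i) _ → refl }
    inner : ∀ k → E n (λ c → γ k * w c * H (k ∷ c)) ≡ γ k * Z
    inner k = trans (E-cong n λ c → trans (*-assoc (γ k) (w c) _)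
      (cong (λ h → γ k * (w c * h)) (H-const k c))) (E-* n (γ k) _)
    EH : E (suc n) H ≡ K * E n H₀
    EH = trans (sum-cong-≗ λ k → E-cong n (H-const k)) (sum-const K (E n H₀))
    ind₀ : IndependentOf S′ H₀
    ind₀ c c′ eq = ind _ _ λ { zero _ → refl ; (suc i) f → eq i f }
    r₁ : ∀ a z k x → a * z * (k * x) ≡ a * k * (z * x)
    r₁ = solve-∀
    r₂ : ∀ a k x y → a * k * (x * y) ≡ a * x * (k * y)
    r₂ = solve-∀
... | false = begin
    sum (λ k → E n (λ c → 1 * w c * H (k ∷ c))) * K ^ s
      ≡⟨ sum-* (λ k → E n (λ c → 1 * w c * H (k ∷ c))) (K ^ s) ⟩
    sum (λ k → E n (λ c → 1 * w c * H (k ∷ c)) * K ^ s)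
      ≡⟨ sum-cong-≗ (λ k → trans (cong (_* K ^ s) (E-cong n λ c → cong (_* H (k ∷ c)) (*-identityˡ (w c))))
                     (factor n S′ γ (λ c → H (k ∷ c)) (ind′ k))) ⟩
    sum (λ k → sum γ ^ s * E n (λ c → H (k ∷ c)))
      ≡⟨ sym (*-distribˡ-sum (sum γ ^ s) (λ k → E n (λ c → H (k ∷ c)))) ⟩
    sum γ ^ s * E (suc n) H  ∎
    where
    open ≡-Reasoning
    K = suc K-1
    S′ = S ∘ suc
    s = count S′
    w = weight S′ γ
    ind′ : ∀ k → IndependentOf S′ (λ c → H (k ∷ c))
    ind′ k c c′ eq = ind _ _ λ { zero _ → refl ; (suc i) f → eq i f }

-- The symmetric local lemma in counting form: conditional probabilities become inequalities between
-- unnormalised expectations, which avoids division and conditioning on null events.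
module LocalLemma {K : ℕ} .{{_ : NonZero K}} {n : ℕ} (Bad : Fin n → Vec (Fin K) n → Bool)
  (rel : Fin n → Fin n → Bool) (Δ : ℕ) .{{_ : NonZero Δ}} where

  good : List (Fin n) → Vec (Fin K) n → ℕ
  good []      c = 1
  good (v ∷ l) c = ⟦ not (Bad v c) ⟧ * good l c

  bad∧good : Fin n → List (Fin n) → Vec (Fin K) n → ℕ
  bad∧good v l c = ⟦ Bad v c ⟧ * good l c

  SmallDegree : List (Fin n) → Set
  SmallDegree l = ∀ v → length (filterᵇ (rel v) l) ≤ Δ

  private
    b* : ∀ b x → ⟦ b ⟧ * x ≤ x
    b* true  x = ≤-reflexive (*-identityˡ x)
    b* false x = z≤n

    split : ∀ b x → x ≡ ⟦ not b ⟧ * x + ⟦ b ⟧ * x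
    split true  x = sym (+-identityʳ x)
    split false x = sym (trans (+-identityʳ _) (+-identityʳ x))

  E-split : ∀ v l → E n (good l) ≡ E n (good (v ∷ l)) + E n (bad∧good v l)
  E-split v l = trans (E-cong n λ c → split (Bad v c) (good l c)) (E-+ n _ _)

  good-++ : ∀ l l′ c → good (l ++ l′) c ≤ good l′ c
  good-++ []      l′ c = ≤-refl
  good-++ (v ∷ l) l′ c = ≤-trans (b* (not (Bad v c)) _) (good-++ l l′ c)

  -- The order of the factors is irrelevant, so the events related to a given vertex can be moved to
  -- the front.
  good-filter : ∀ (p : Fin n → Bool) l c →
                good l c ≡ good (filterᵇ p l ++ filterᵇ (not ∘ p) l) c
  good-filter p []      c = refl
  good-filter p (v ∷ l) c with p v
  ... | true  = cong (⟦ not (Bad v c) ⟧ *_) (good-filter p l c)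
  ... | false = trans (cong (⟦ not (Bad v c) ⟧ *_) (good-filter p l c)) (move (filterᵇ p l))
    where
    l₂ = filterᵇ (not ∘ p) l
    r : ∀ x y z → x * (y * z) ≡ y * (x * z)
    r = solve-∀
    move : ∀ l₁ → ⟦ not (Bad v c) ⟧ * good (l₁ ++ l₂) c ≡ good (l₁ ++ v ∷ l₂) c
    move []       = refl
    move (w ∷ l₁) = trans (r ⟦ not (Bad v c) ⟧ ⟦ not (Bad w c) ⟧ _)
                          (cong (⟦ not (Bad w c) ⟧ *_) (move l₁))

  -- The events of l₁ are added one at a time. Each removes at most a fraction 1 / (2 Δ) of the mass
  -- of `good l₂`, since its bad part only grows when the events added before it are dropped.
  union-bound : ∀ l₁ l₂ → All (λ w → 2 * Δ * E n (bad∧good w l₂) ≤ E n (good l₂)) l₁ →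
                2 * Δ * E n (good l₂) ≤ 2 * Δ * E n (good (l₁ ++ l₂)) + length l₁ * E n (good l₂)
  union-bound []       l₂ []       = m≤m+n _ _
  union-bound (w ∷ l₁) l₂ (b ∷ bs) = begin
    2Δ * g₂                                        ≤⟨ union-bound l₁ l₂ bs ⟩
    2Δ * E n (good (l₁ ++ l₂)) + k * g₂            ≡⟨ cong (λ x → 2Δ * x + k * g₂) (E-split w (l₁ ++ l₂)) ⟩
    2Δ * (a + E n (bad∧good w (l₁ ++ l₂))) + k * g₂
      ≤⟨ +-monoˡ-≤ _ (*-monoʳ-≤ 2Δ (+-monoʳ-≤ a (E-mono n λ c → *-monoʳ-≤ ⟦ Bad w c ⟧ (good-++ l₁ l₂ c)))) ⟩
    2Δ * (a + E n (bad∧good w l₂)) + k * g₂        ≡⟨ cong (_+ k * g₂) (*-distribˡ-+ 2Δ a _) ⟩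
    2Δ * a + 2Δ * E n (bad∧good w l₂) + k * g₂     ≤⟨ +-monoˡ-≤ _ (+-monoʳ-≤ (2Δ * a) b) ⟩
    2Δ * a + g₂ + k * g₂                           ≡⟨ +-assoc (2Δ * a) g₂ _ ⟩
    2Δ * a + (g₂ + k * g₂)                         ∎
    where
    open ≤-Reasoning
    2Δ = 2 * Δ
    g₂ = E n (good l₂)
    a  = E n (good (w ∷ l₁ ++ l₂))
    k  = length l₁

  length-filter² : ∀ (p q : Fin n → Bool) l →
                   length (filterᵇ p (filterᵇ q l)) ≤ length (filterᵇ p l)
  length-filter² p q []      = z≤n
  length-filter² p q (v ∷ l) with q v
  length-filter² p q (v ∷ l) | true with p v
  ... | true  = s≤s (length-filter² p q l)
  ... | false = length-filter² p q l
  length-filter² p q (v ∷ l) | false with p v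
  ... | true  = m≤n⇒m≤1+n (length-filter² p q l)
  ... | false = length-filter² p q l

  length-split : ∀ (p : Fin n → Bool) l →
                 length (filterᵇ p l) + length (filterᵇ (not ∘ p) l) ≡ length l
  length-split p []      = refl
  length-split p (v ∷ l) with p v
  ... | true  = cong suc (length-split p l)
  ... | false = trans (+-suc _ _) (cong suc (length-split p l))

  all-filter : ∀ (p : Fin n → Bool) l → All (λ w → p w ≡ false) (filterᵇ (not ∘ p) l)
  all-filter p []      = []
  all-filter p (v ∷ l) with p v in eq
  ... | true  = all-filter p l
  ... | false = eq ∷ all-filter p l

  -- Independence enters through `rare`: given that any unrelated vertices are good, v is bad with
  -- probability at most 1 / (4 Δ).
  module _ (rare : ∀ v l → All (λ w → rel v w ≡ false) l →
                   4 * Δ * E n (bad∧good v l) ≤ E n (good l)) where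

    -- Given only the unrelated part l₂, the probability is at most 1 / (4 Δ). The at most Δ related
    -- events have conditional probability at most 1 / (2 Δ) each by induction, so adding them keeps
    -- half of the mass of `good l₂` and costs a factor 2. The recursion is on k, as l₂ is shorter
    -- than l once l₁ is nonempty.
    conditional : ∀ k l → length l ≤ k → SmallDegree l →
                  ∀ v → 2 * Δ * E n (bad∧good v l) ≤ E n (good l)
    conditional k l len small v = *-cancelˡ-≤ 2 (begin
      2 * (2 * Δ * E n (bad∧good v l))   ≤⟨ *-monoʳ-≤ 2 (*-monoʳ-≤ (2 * Δ) bad≤) ⟩
      2 * (2 * Δ * E n (bad∧good v l₂))  ≡⟨ r₁ Δ _ ⟩
      4 * Δ * E n (bad∧good v l₂)        ≤⟨ rare v l₂ (all-filter (rel v) l) ⟩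
      g₂                                 ≤⟨ g₂≤ ⟩
      2 * E n (good l)                   ∎)
      where
      open ≤-Reasoning
      l₁ = filterᵇ (rel v) l
      l₂ = filterᵇ (not ∘ rel v) l
      g₂ = E n (good l₂)
      r₁ : ∀ d x → 2 * (2 * d * x) ≡ 4 * d * x
      r₁ = solve-∀
      r₂ : ∀ d x → 2 * d * x ≡ d * x + d * x
      r₂ = solve-∀
      r₃ : ∀ d x → 2 * d * x ≡ d * (2 * x)
      r₃ = solve-∀
      bad≤ : E n (bad∧good v l) ≤ E n (bad∧good v l₂)
      bad≤ = E-mono n λ c → *-monoʳ-≤ ⟦ Bad v c ⟧
        (≤-trans (≤-reflexive (good-filter (rel v) l c)) (good-++ l₁ l₂ c))
      IH : ∀ k → length l ≤ k → ∀ l₁ → length l₁ + length l₂ ≡ length l →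
           All (λ w → 2 * Δ * E n (bad∧good w l₂) ≤ E n (good l₂)) l₁
      IH k       len []       eq = []
      IH zero    len (_ ∷ l₁) eq with () ← subst (_≤ 0) (sym eq) len
      IH (suc k) len (_ ∷ l₁) eq = All.tabulate λ {w} _ → conditional k l₂
        (≤-trans (m≤n+m _ (length l₁)) (s≤s⁻¹ (subst (_≤ suc k) (sym eq) len)))
        (λ w → ≤-trans (length-filter² (rel w) (not ∘ rel v) l) (small w)) w
      g₂≤ : g₂ ≤ 2 * E n (good l)
      g₂≤ = *-cancelˡ-≤ Δ (+-cancelʳ-≤ (Δ * g₂) _ _ (begin
        Δ * g₂ + Δ * g₂   ≡⟨ sym (r₂ Δ g₂) ⟩
        2 * Δ * g₂        ≤⟨ union-bound l₁ l₂ (IH k len l₁ (length-split (rel v) l)) ⟩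
        2 * Δ * E n (good (l₁ ++ l₂)) + length l₁ * g₂
          ≤⟨ +-monoʳ-≤ _ (*-monoˡ-≤ g₂ (small v)) ⟩
        2 * Δ * E n (good (l₁ ++ l₂)) + Δ * g₂
          ≡⟨ cong (λ x → 2 * Δ * x + Δ * g₂) (sym (E-cong n (good-filter (rel v) l))) ⟩
        2 * Δ * E n (good l) + Δ * g₂
          ≡⟨ cong (_+ Δ * g₂) (r₃ Δ _) ⟩
        Δ * (2 * E n (good l)) + Δ * g₂ ∎))

    -- By `conditional`, making v good as well removes at most half of a positive mass.
    good>0 : ∀ l → SmallDegree l → 0 < E n (good l)
    good>0 []      small = E1>0 n
    good>0 (v ∷ l) small = ≰⇒> λ a≤0 → <⇒≱ (m<m+n g (subst (0 <_) (sym (+-identityʳ g)) g>0)) (begin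
        2 * g            ≡⟨ cong (2 *_) (E-split v l) ⟩
        2 * (a + b)      ≤⟨ *-monoʳ-≤ 2 (+-monoˡ-≤ b a≤0) ⟩
        2 * b            ≤⟨ *-monoˡ-≤ b (m≤m*n 2 Δ) ⟩
        2 * Δ * b        ≤⟨ conditional (length l) l ≤-refl tail-small v ⟩
        g                ∎)
      where
      open ≤-Reasoning
      a = E n (good (v ∷ l))
      b = E n (bad∧good v l)
      tail-small : SmallDegree l
      tail-small w with small w
      ... | s with rel w v
      ...   | true  = ≤-trans (n≤1+n _) s
      ...   | false = s
      g = E n (good l)
      g>0 = good>0 l tail-small

-- Power inequalities for the Chernoff bounds

^-distribʳ-* : ∀ n a b → (a * b) ^ n ≡ a ^ n * b ^ n
^-distribʳ-* zero    a b = refl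
^-distribʳ-* (suc n) a b = trans (cong (a * b *_) (^-distribʳ-* n a b)) (r a b (a ^ n) (b ^ n))
  where
  r : ∀ a b x y → a * b * (x * y) ≡ a * x * (b * y)
  r = solve-∀

-- Bernoulli's inequality (1 - 1 / (K + 1)) ^ j ≥ 1 - j / (K + 1), with r for K + 1 - j to avoid
-- subtraction.
[1+K]^ : ∀ K j r → j + r ≡ suc K → suc K ^ j * r ≤ K ^ j * suc K
[1+K]^ K zero    r eq = ≤-reflexive (cong (_+ 0) eq)
[1+K]^ K (suc j) r eq = begin
  suc K * suc K ^ j * r     ≡⟨ r₁ (suc K) (suc K ^ j) r ⟩
  suc K ^ j * (r + K * r)   ≤⟨ *-monoʳ-≤ (suc K ^ j) (+-monoˡ-≤ (K * r) r≤K) ⟩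
  suc K ^ j * (K + K * r)   ≡⟨ r₂ (suc K ^ j) K r ⟩
  K * (suc K ^ j * suc r)   ≤⟨ *-monoʳ-≤ K ([1+K]^ K j (suc r) (trans (+-suc j r) eq)) ⟩
  K * (K ^ j * suc K)       ≡⟨ sym (*-assoc K (K ^ j) (suc K)) ⟩
  K * K ^ j * suc K         ∎
  where
  open ≤-Reasoning
  r≤K : r ≤ K
  r≤K = subst (r ≤_) (suc-injective eq) (m≤n+m r j)
  r₁ : ∀ a b r → a * b * r ≡ b * (a * r)
  r₁ = solve-∀
  r₂ : ∀ a k r → a * (k + k * r) ≡ k * (a * suc r)
  r₂ = solve-∀

[1+2m]^≤ : ∀ m j → j ≤ m → suc (2 * m) ^ j ≤ 2 * (2 * m) ^ j
[1+2m]^≤ m j j≤m = *-cancelʳ-≤ _ _ (suc m) (begin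
  suc (2 * m) ^ j * suc m        ≤⟨ *-monoʳ-≤ (suc (2 * m) ^ j) m<r ⟩
  suc (2 * m) ^ j * r            ≤⟨ [1+K]^ (2 * m) j r (m+[n∸m]≡n (≤-trans j≤m (≤-trans (m≤n*m m 2) (n≤1+n _)))) ⟩
  (2 * m) ^ j * suc (2 * m)      ≤⟨ *-monoʳ-≤ ((2 * m) ^ j) (≤-trans (n≤1+n _) (≤-reflexive (r₁ m))) ⟩
  (2 * m) ^ j * (2 * suc m)      ≡⟨ r₂ ((2 * m) ^ j) (suc m) ⟩
  2 * (2 * m) ^ j * suc m        ∎)
  where
  open ≤-Reasoning
  r = suc (2 * m) ∸ j
  m<r : suc m ≤ r
  m<r = m+n≤o⇒n≤o∸m j (≤-trans (+-monoˡ-≤ (suc m) j≤m) (≤-reflexive (r₃ m)))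
    where
    m+n≤o⇒n≤o∸m : ∀ a {b c} → a + b ≤ c → b ≤ c ∸ a
    m+n≤o⇒n≤o∸m a {b} {c} le = subst (_≤ c ∸ a) (m+n∸m≡n a b) (∸-monoˡ-≤ a le)
    r₃ : ∀ m → m + suc m ≡ suc (2 * m)
    r₃ = solve-∀
  r₁ : ∀ m → suc (suc (2 * m)) ≡ 2 * suc m
  r₁ = solve-∀
  r₂ : ∀ a b → a * (2 * b) ≡ 2 * a * b
  r₂ = solve-∀

-- The exponent D is cut into ⌊D / m⌋ blocks of length m and a shorter remainder; each piece of (1 +
-- 1 / (2 m)) ^ D is at most 2.
[1+2m]^D≤ : ∀ m .{{_ : NonZero m}} D → suc (2 * m) ^ D ≤ 2 ^ suc (D ℕ./ m) * (2 * m) ^ D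
[1+2m]^D≤ m D = begin
  suc K ^ D                                  ≡⟨ expand (suc K) ⟩
  suc K ^ ρ * (suc K ^ m) ^ z                ≤⟨ *-mono-≤ ([1+2m]^≤ m ρ (<⇒≤ (m%n<n D m)))
                                                  (^-monoˡ-≤ z ([1+2m]^≤ m m ≤-refl)) ⟩
  2 * K ^ ρ * (2 * K ^ m) ^ z                ≡⟨ cong (2 * K ^ ρ *_) (^-distribʳ-* z 2 (K ^ m)) ⟩
  2 * K ^ ρ * (2 ^ z * (K ^ m) ^ z)          ≡⟨ r₁ (K ^ ρ) (2 ^ z) ((K ^ m) ^ z) ⟩
  2 * 2 ^ z * (K ^ ρ * (K ^ m) ^ z)          ≡⟨ cong (2 * 2 ^ z *_) (sym (expand K)) ⟩
  2 * 2 ^ z * K ^ D                          ∎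
  where
  open ≤-Reasoning
  K = 2 * m
  ρ = D ℕ.% m
  z = D ℕ./ m
  expand : ∀ x → x ^ D ≡ x ^ ρ * (x ^ m) ^ z
  expand x = trans (cong (x ^_) (trans (m≡m%n+[m/n]*n D m) (cong (λ y → ρ + y) (*-comm z m))))
    (trans (^-distribˡ-+-* x ρ (m * z)) (cong (x ^ ρ *_) (sym (^-*-assoc x m z))))
  r₁ : ∀ a b c → 2 * a * (b * c) ≡ 2 * b * (a * c)
  r₁ = solve-∀

bernoulli : ∀ p j → p ^ j * (p + j) ≤ p * suc p ^ j
bernoulli p zero    = ≤-reflexive (r p)
  where
  r : ∀ p → 1 * (p + 0) ≡ p * 1
  r = solve-∀
bernoulli p (suc j) = begin
  p * p ^ j * (p + suc j)          ≤⟨ m≤m+n _ (p ^ j * j) ⟩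
  p * p ^ j * (p + suc j) + p ^ j * j ≡⟨ r₁ p (p ^ j) j ⟩
  p ^ j * (p + j) * suc p          ≤⟨ *-monoˡ-≤ (suc p) (bernoulli p j) ⟩
  p * suc p ^ j * suc p            ≡⟨ r₂ p (suc p ^ j) ⟩
  p * (suc p * suc p ^ j)          ∎
  where
  open ≤-Reasoning
  r₁ : ∀ p a j → p * a * (p + suc j) + a * j ≡ a * (p + j) * suc p
  r₁ = solve-∀
  r₂ : ∀ p a → p * a * suc p ≡ p * (suc p * a)
  r₂ = solve-∀

2*p^≤ : ∀ p .{{_ : NonZero p}} → 2 * p ^ suc p ≤ suc p ^ suc p
2*p^≤ p = *-cancelˡ-≤ p (begin
  p * (2 * p ^ suc p)             ≤⟨ m≤m+n _ (p ^ suc p) ⟩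
  p * (2 * p ^ suc p) + p ^ suc p ≡⟨ r₁ p (p ^ suc p) ⟩
  p ^ suc p * (p + suc p)         ≤⟨ bernoulli p (suc p) ⟩
  p * suc p ^ suc p               ∎)
  where
  open ≤-Reasoning
  r₁ : ∀ p a → p * (2 * a) + a ≡ a * (p + suc p)
  r₁ = solve-∀

-- Each of y blocks of p + 1 factors p / (p + 1) is at most 1 / 2 by `2*p^≤`, and the remaining
-- factors are at most 1.
p^D*2^y≤ : ∀ p .{{_ : NonZero p}} y D → suc p * y ≤ D → p ^ D * 2 ^ y ≤ suc p ^ D
p^D*2^y≤ p y D le = begin
  p ^ D * 2 ^ y                       ≡⟨ cong (_* 2 ^ y) (expand p) ⟩
  p ^ ρ * (p ^ suc p) ^ y * 2 ^ y     ≡⟨ r₁ (p ^ ρ) ((p ^ suc p) ^ y) (2 ^ y) ⟩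
  p ^ ρ * (2 ^ y * (p ^ suc p) ^ y)   ≡⟨ cong (p ^ ρ *_) (sym (^-distribʳ-* y 2 (p ^ suc p))) ⟩
  p ^ ρ * (2 * p ^ suc p) ^ y         ≤⟨ *-mono-≤ (^-monoˡ-≤ ρ (n≤1+n p)) (^-monoˡ-≤ y (2*p^≤ p)) ⟩
  suc p ^ ρ * (suc p ^ suc p) ^ y     ≡⟨ sym (expand (suc p)) ⟩
  suc p ^ D                           ∎
  where
  open ≤-Reasoning
  ρ = D ∸ suc p * y
  expand : ∀ x → x ^ D ≡ x ^ ρ * (x ^ suc p) ^ y
  expand x = trans (cong (x ^_) (sym (m∸n+n≡m le)))
    (trans (^-distribˡ-+-* x ρ (suc p * y)) (cong (x ^ ρ *_) (sym (^-*-assoc x (suc p) y))))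
  r₁ : ∀ a b c → a * b * c ≡ a * (c * b)
  r₁ = solve-∀

-- Occurrences of a label and their Chernoff bounds

<ᵇ≡⇒< : ∀ {m n} → (m <ᵇ n) ≡ true → m < n
<ᵇ≡⇒< {m} {n} eq = <ᵇ⇒< m n (Equivalence.from T-≡ eq)

count-none : ∀ {n} (p : Fin n → Bool) → (∀ i → p i ≡ false) → count p ≡ 0
count-none {n} p none = trans (sum-cong-≗ λ i → cong ⟦_⟧ (none i)) (trans (sum-const n 0) (*-zeroʳ n))

count-≟ : ∀ {n} (j : Fin n) → count (λ i → does (i Finₚ.≟ j)) ≡ 1
count-≟ {suc n} zero    = cong suc (count-none (λ i → does (suc i Finₚ.≟ (Fin.zero {n}))) λ _ → refl)
count-≟ {suc n} (suc j) = count-≟ j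

module _ {K : ℕ} where

  occ : ∀ {n} → (Fin n → Bool) → Fin K → Vec (Fin K) n → ℕ
  occ S j c = count λ w → S w ∧ does (lookup c w Finₚ.≟ j)

  occ-cong : ∀ {n} (S : Fin n → Bool) j c c′ → (∀ i → S i ≡ true → lookup c i ≡ lookup c′ i) →
             occ S j c ≡ occ S j c′
  occ-cong S j c c′ eq = sum-cong-≗ λ i → cong ⟦_⟧ (pt i)
    where
    pt : ∀ i → S i ∧ does (lookup c i Finₚ.≟ j) ≡ S i ∧ does (lookup c′ i Finₚ.≟ j)
    pt i with S i in Si
    ... | true  = cong (λ x → does (x Finₚ.≟ j)) (eq i Si)
    ... | false = refl

  -- The weights of γ⁺ and γ⁻ are 2 ^ X and 2 ^ (∣ S ∣ ∸ X) for X = occ S j c, so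
  -- that their expectations bound the upper and the lower tail of X.
  γ⁺ γ⁻ : Fin K → Fin K → ℕ
  γ⁺ j k = if does (k Finₚ.≟ j) then 2 else 1
  γ⁻ j k = if does (k Finₚ.≟ j) then 1 else 2

  weight⁺ : ∀ {n} (S : Fin n → Bool) j (c : Vec (Fin K) n) → weight S (γ⁺ j) c ≡ 2 ^ occ S j c
  weight⁺ S j [] = refl
  weight⁺ S j (k ∷ c) with S zero
  ... | false = trans (*-identityˡ _) (weight⁺ (S ∘ suc) j c)
  ... | true with does (k Finₚ.≟ j)
  ...   | true  = cong (2 *_) (weight⁺ (S ∘ suc) j c)
  ...   | false = trans (*-identityˡ _) (weight⁺ (S ∘ suc) j c)

  weight⁻ : ∀ {n} (S : Fin n → Bool) j (c : Vec (Fin K) n) →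
            weight S (γ⁻ j) c * 2 ^ occ S j c ≡ 2 ^ count S
  weight⁻ S j [] = refl
  weight⁻ S j (k ∷ c) with S zero
  ... | false = trans (cong (_* 2 ^ occ (S ∘ suc) j c) (*-identityˡ (weight (S ∘ suc) (γ⁻ j) c))) (weight⁻ (S ∘ suc) j c)
  ... | true with does (k Finₚ.≟ j)
  ...   | true  = trans (r (weight (S ∘ suc) (γ⁻ j) c) (2 ^ occ (S ∘ suc) j c))
                        (cong (2 *_) (weight⁻ (S ∘ suc) j c))
    where
    r : ∀ a b → 1 * a * (2 * b) ≡ 2 * (a * b)
    r = solve-∀
  ...   | false = trans (*-assoc 2 (weight (S ∘ suc) (γ⁻ j) c) (2 ^ occ (S ∘ suc) j c)) (cong (2 *_) (weight⁻ (S ∘ suc) j c))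

  sum-γ⁺ : ∀ j → sum (γ⁺ j) ≡ suc K
  sum-γ⁺ j = begin
    sum (γ⁺ j)                                     ≡⟨ sum-cong-≗ pt ⟩
    sum (λ k → ⟦ does (k Finₚ.≟ j) ⟧ + 1)          ≡⟨ ∑-distrib-+ (λ k → ⟦ does (k Finₚ.≟ j) ⟧) (λ _ → 1) ⟩
    count (λ k → does (k Finₚ.≟ j)) + sum {K} (λ _ → 1)
      ≡⟨ cong₂ _+_ (count-≟ j) (trans (sum-const K 1) (*-identityʳ K)) ⟩
    suc K                                          ∎
    where
    open ≡-Reasoning
    pt : ∀ k → γ⁺ j k ≡ ⟦ does (k Finₚ.≟ j) ⟧ + 1
    pt k with does (k Finₚ.≟ j)
    ... | true  = refl
    ... | false = refl

  sum-γ⁻ : ∀ j → suc (sum (γ⁻ j)) ≡ 2 * K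
  sum-γ⁻ j = begin
    suc (sum (γ⁻ j))                               ≡⟨ cong (_+ sum (γ⁻ j)) (sym (count-≟ j)) ⟩
    count (λ k → does (k Finₚ.≟ j)) + sum (γ⁻ j)   ≡⟨ sym (∑-distrib-+ (λ k → ⟦ does (k Finₚ.≟ j) ⟧) (γ⁻ j)) ⟩
    sum (λ k → ⟦ does (k Finₚ.≟ j) ⟧ + γ⁻ j k)     ≡⟨ sum-cong-≗ pt ⟩
    sum {K} (λ _ → 2)                              ≡⟨ trans (sum-const K 2) (*-comm K 2) ⟩
    2 * K                                          ∎
    where
    open ≡-Reasoning
    pt : ∀ k → ⟦ does (k Finₚ.≟ j) ⟧ + γ⁻ j k ≡ 2
    pt k with does (k Finₚ.≟ j)
    ... | true  = refl
    ... | false = refl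

E-factor : ∀ {K} .{{_ : NonZero K}} n (S : Fin n → Bool) (γ : Fin K → ℕ) H → IndependentOf S H →
           E n (λ c → weight S γ c * H c) * K ^ count S ≡ sum γ ^ count S * E n H
E-factor {suc _} = factor

module Chernoff (m : ℕ) .{{_ : NonZero m}} where

  K : ℕ
  K = 2 * m

  instance
    K≢0 : NonZero K
    K≢0 = m*n≢0 2 m

    8m≢0 : NonZero (8 * m)
    8m≢0 = m*n≢0 8 m

  module _ {n} (S : Fin n → Bool) (j : Fin K) where

    D = count S

    -- The mean number of occurrences is D / (2 m), so these events are exceeding four times the
    -- mean and falling below a quarter of it.
    tooMany tooFew : Vec (Fin K) n → Bool
    tooMany c = 2 * D <ᵇ m * occ S j c
    tooFew  c = 8 * m * occ S j c <ᵇ D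

    -- H is to be the indicator that unrelated vertices are good; carrying it along makes the tail
    -- bounds conditional, as the local lemma needs.
    module _ (H : Vec (Fin K) n → ℕ) (ind : IndependentOf S H) where

      instance
        K^D≢0 : NonZero (K ^ D)
        K^D≢0 = m^n≢0 K D

      -- Markov's inequality for 2 ^ X with X = `occ S j c` and z = ⌊D / m⌋: the mean (1 + 1 / K) ^
      -- D is at most 2 ^ (z + 1), and `tooMany` forces X ≥ 2 z + 1.
      upper : 2 ^ (D ℕ./ m) * E n (λ c → ⟦ tooMany c ⟧ * H c) ≤ E n H
      upper = *-cancelˡ-≤ (2 ^ suc z) {{m^n≢0 2 (suc z)}} (*-cancelʳ-≤ _ _ (K ^ D) (begin
        2 ^ suc z * (2 ^ z * E n (λ c → ⟦ tooMany c ⟧ * H c)) * K ^ D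
          ≡⟨ cong (_* K ^ D) (trans (sym (*-assoc (2 ^ suc z) (2 ^ z) _)) (cong (_* E n (λ c → ⟦ tooMany c ⟧ * H c)) (sym (^-distribˡ-+-* 2 (suc z) z)))) ⟩
        2 ^ (suc z + z) * E n (λ c → ⟦ tooMany c ⟧ * H c) * K ^ D
          ≡⟨ cong (_* K ^ D) (sym (E-* n (2 ^ (suc z + z)) _)) ⟩
        E n (λ c → 2 ^ (suc z + z) * (⟦ tooMany c ⟧ * H c)) * K ^ D
          ≤⟨ *-monoˡ-≤ (K ^ D) (E-mono n pt) ⟩
        E n (λ c → weight S (γ⁺ j) c * H c) * K ^ D
          ≡⟨ E-factor n S (γ⁺ j) H ind ⟩
        sum (γ⁺ j) ^ D * E n H
          ≡⟨ cong (λ x → x ^ D * E n H) (sum-γ⁺ j) ⟩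
        suc K ^ D * E n H
          ≤⟨ *-monoˡ-≤ (E n H) ([1+2m]^D≤ m D) ⟩
        2 ^ suc z * K ^ D * E n H
          ≡⟨ r (2 ^ suc z) (K ^ D) (E n H) ⟩
        2 ^ suc z * E n H * K ^ D ∎))
        where
        open ≤-Reasoning
        z = D ℕ./ m
        r : ∀ a b c → a * b * c ≡ a * c * b
        r = solve-∀
        pt : ∀ c → 2 ^ (suc z + z) * (⟦ tooMany c ⟧ * H c) ≤ weight S (γ⁺ j) c * H c
        pt c with tooMany c in eq
        ... | false = ≤-trans (≤-reflexive (*-zeroʳ (2 ^ (suc z + z)))) z≤n
        ... | true = ≤-trans (≤-reflexive (cong (2 ^ (suc z + z) *_) (*-identityˡ (H c))))
          (*-monoˡ-≤ (H c) (≤-trans (^-monoʳ-≤ 2 X≥) (≤-reflexive (sym (weight⁺ S j c)))))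
          where
          lt : 2 * D < m * occ S j c
          lt = <ᵇ≡⇒< eq
          X≥ : suc z + z ≤ occ S j c
          X≥ = *-cancelˡ-< m (z + z) (occ S j c) (≤-<-trans (begin
            m * (z + z)   ≡⟨ r′ m z ⟩
            2 * (z * m)   ≤⟨ *-monoʳ-≤ 2 (m/n*n≤m D m) ⟩
            2 * D         ∎) lt)
            where
            r′ : ∀ m z → m * (z + z) ≡ 2 * (z * m)
            r′ = solve-∀

      -- Markov's inequality for the inverse of 2 ^ X: its mean is (p / (p + 1)) ^ D with p + 1 = 4
      -- m, hence at most 1 / 2 ^ (2 x) for x = ⌊D / (8 m)⌋, and `tooFew` forces X ≤ x.
      lower : 2 ^ (D ℕ./ (8 * m)) * E n (λ c → ⟦ tooFew c ⟧ * H c) ≤ E n H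
      lower = *-cancelˡ-≤ (2 ^ x) {{m^n≢0 2 x}} (*-cancelʳ-≤ _ _ (suc p ^ D) {{m^n≢0 (suc p) D}} (begin
        2 ^ x * (2 ^ x * B) * suc p ^ D   ≡⟨ cong₂ _*_ (trans (sym (*-assoc (2 ^ x) (2 ^ x) B)) (cong (_* B) (sym (^-distribˡ-+-* 2 x x)))) N^D ⟩
        2 ^ (x + x) * B * (2 ^ D * K ^ D) ≡⟨ r₁ (2 ^ (x + x)) B (2 ^ D) (K ^ D) ⟩
        2 ^ (x + x) * (2 ^ D * B * K ^ D) ≤⟨ *-monoʳ-≤ (2 ^ (x + x)) main ⟩
        2 ^ (x + x) * (2 ^ x * (p ^ D * E n H)) ≡⟨ r₂ (2 ^ (x + x)) (2 ^ x) (p ^ D) (E n H) ⟩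
        2 ^ x * E n H * (p ^ D * 2 ^ (x + x)) ≤⟨ *-monoʳ-≤ (2 ^ x * E n H) (p^D*2^y≤ p {{p≢0}} (x + x) D N*2x≤) ⟩
        2 ^ x * E n H * suc p ^ D         ∎))
        where
        open ≤-Reasoning
        x = D ℕ./ (8 * m)
        p = sum (γ⁻ j)
        B = E n (λ c → ⟦ tooFew c ⟧ * H c)
        p≢0 : NonZero p
        p≢0 = >-nonZero (s≤s⁻¹ (subst (2 ≤_) (sym (sum-γ⁻ j)) (*-monoʳ-≤ 2 (>-nonZero⁻¹ K))))
        N^D : suc p ^ D ≡ 2 ^ D * K ^ D
        N^D = trans (cong (_^ D) (sum-γ⁻ j)) (^-distribʳ-* D 2 K)
        r₁ : ∀ a b c d → a * b * (c * d) ≡ a * (c * b * d)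
        r₁ = solve-∀
        r₂ : ∀ a b c d → a * (b * (c * d)) ≡ b * d * (c * a)
        r₂ = solve-∀
        N*2x≤ : suc p * (x + x) ≤ D
        N*2x≤ = begin
          suc p * (x + x)   ≡⟨ cong (_* (x + x)) (sum-γ⁻ j) ⟩
          2 * (2 * m) * (x + x) ≡⟨ r₃ m x ⟩
          x * (8 * m)       ≤⟨ m/n*n≤m D (8 * m) ⟩
          D                 ∎
          where
          r₃ : ∀ m x → 2 * (2 * m) * (x + x) ≡ x * (8 * m)
          r₃ = solve-∀
        pt : ∀ c → 2 ^ D * (⟦ tooFew c ⟧ * H c) ≤ 2 ^ x * (weight S (γ⁻ j) c * H c)
        pt c with tooFew c in eq
        ... | false = ≤-trans (≤-reflexive (*-zeroʳ (2 ^ D))) z≤n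
        ... | true = begin
          2 ^ D * (1 * H c)                            ≡⟨ cong₂ _*_ (sym (weight⁻ S j c)) (*-identityˡ (H c)) ⟩
          weight S (γ⁻ j) c * 2 ^ occ S j c * H c      ≤⟨ *-monoˡ-≤ (H c) (*-monoʳ-≤ (weight S (γ⁻ j) c) (^-monoʳ-≤ 2 X≤)) ⟩
          weight S (γ⁻ j) c * 2 ^ x * H c              ≡⟨ r₄ (weight S (γ⁻ j) c) (2 ^ x) (H c) ⟩
          2 ^ x * (weight S (γ⁻ j) c * H c)            ∎
          where
          lt : 8 * m * occ S j c < D
          lt = <ᵇ≡⇒< eq
          r₄ : ∀ a b c → a * b * c ≡ b * (a * c)
          r₄ = solve-∀
          X≤ : occ S j c ≤ x
          X≤ = ≤-trans (≤-reflexive (sym (m*n/n≡m (occ S j c) (8 * m))))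
                       (/-monoˡ-≤ (8 * m) (≤-trans (≤-reflexive (*-comm (occ S j c) (8 * m))) (<⇒≤ lt)))
        main : 2 ^ D * B * K ^ D ≤ 2 ^ x * (p ^ D * E n H)
        main = begin
          2 ^ D * B * K ^ D                                  ≡⟨ cong (_* K ^ D) (sym (E-* n (2 ^ D) _)) ⟩
          E n (λ c → 2 ^ D * (⟦ tooFew c ⟧ * H c)) * K ^ D   ≤⟨ *-monoˡ-≤ (K ^ D) (E-mono n pt) ⟩
          E n (λ c → 2 ^ x * (weight S (γ⁻ j) c * H c)) * K ^ D ≡⟨ cong (_* K ^ D) (E-* n (2 ^ x) _) ⟩
          2 ^ x * E n (λ c → weight S (γ⁻ j) c * H c) * K ^ D ≡⟨ *-assoc (2 ^ x) _ (K ^ D) ⟩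
          2 ^ x * (E n (λ c → weight S (γ⁻ j) c * H c) * K ^ D) ≡⟨ cong (2 ^ x *_) (E-factor n S (γ⁻ j) H ind) ⟩
          2 ^ x * (p ^ D * E n H)                            ∎

-- The splitting lemma

≤sum : ∀ {n} (f : Fin n → ℕ) i → f i ≤ sum f
≤sum f zero    = m≤m+n _ _
≤sum f (suc i) = ≤-trans (≤sum (f ∘ suc) i) (m≤n+m _ _)

⟦0<⟧≤ : ∀ m → ⟦ 0 <ᵇ m ⟧ ≤ m
⟦0<⟧≤ zero    = z≤n
⟦0<⟧≤ (suc m) = s≤s z≤n

0<ᵇ-false : ∀ {m} → (0 <ᵇ m) ≡ false → m ≡ 0
0<ᵇ-false {zero} _ = refl

⟦⟧≡0 : ∀ {b} → ⟦ b ⟧ ≡ 0 → b ≡ false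
⟦⟧≡0 {false} _ = refl

<ᵇ-false : ∀ {m n} → (m <ᵇ n) ≡ false → n ≤ m
<ᵇ-false {m} {n} eq = ≮⇒≥ λ lt → contradiction (trans (sym (Equivalence.to T-≡ (<⇒<ᵇ lt))) eq) λ ()

length-filter-tabulate : ∀ {n k} (p : Fin n → Bool) (f : Fin k → Fin n) →
                         length (filterᵇ p (List.tabulate f)) ≡ count (p ∘ f)
length-filter-tabulate {k = zero}  p f = refl
length-filter-tabulate {k = suc k} p f with p (f zero)
... | true  = cong suc (length-filter-tabulate p (f ∘ suc))
... | false = length-filter-tabulate p (f ∘ suc)

-- The local lemma, where v is bad if some label is too frequent or too rare in its neighbourhood,
-- and vertices with a common neighbour are related. Each of the 2 m labels has two tail events of
-- probability at most 1 / 2 ^ q, and the hypothesis on 2 ^ q makes their total 4 m / 2 ^ q at most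
-- 1 / (4 d²).
splitting : ∀ {n} (G : Graph n) (m : ℕ) .{{_ : NonZero m}} (d q : ℕ) .{{_ : NonZero d}} →
            (∀ v → count (adj G v) ≤ d) → (∀ v → 8 * m * q ≤ count (adj G v)) →
            16 * (d * d) * m ≤ 2 ^ q →
            ∃[ c ] ∀ v (j : Fin (2 * m)) →
              count (adj G v) ≤ 8 * m * count (λ w → adj G v w ∧ does (c w Finₚ.≟ j)) ×
              m * count (λ w → adj G v w ∧ does (c w Finₚ.≟ j)) ≤ 2 * count (adj G v)
splitting {n} G m d q deg≤ deg≥ room =
  let c , pos = E>0 n (good>0 rare (allFin n) small) in
  lookup c , λ v j → fair v j c (0<good⇒fair (allFin n) c pos (∈-allFin v))
  where
  open Chernoff m

  bads : Fin n → Fin K → Vec (Fin K) n → ℕ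
  bads v j c = ⟦ tooMany (adj G v) j c ⟧ + ⟦ tooFew (adj G v) j c ⟧

  Bad : Fin n → Vec (Fin K) n → Bool
  Bad v c = 0 <ᵇ sum (λ j → bads v j c)

  common : Fin n → Fin n → Fin n → Bool
  common v w x = adj G v x ∧ adj G w x

  rel : Fin n → Fin n → Bool
  rel v w = 0 <ᵇ count (common v w)

  Δ = d * d
  instance
    Δ≢0 : NonZero Δ
    Δ≢0 = m*n≢0 d d

  open LocalLemma Bad rel Δ

  fair : ∀ v j c → Bad v c ≡ false →
         count (adj G v) ≤ 8 * m * occ (adj G v) j c ×
         m * occ (adj G v) j c ≤ 2 * count (adj G v)
  fair v j c ok = <ᵇ-false (⟦⟧≡0 (m+n≡0⇒n≡0 ⟦ tooMany (adj G v) j c ⟧ none))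
                , <ᵇ-false (⟦⟧≡0 (m+n≡0⇒m≡0 ⟦ tooMany (adj G v) j c ⟧ none))
    where
    none : bads v j c ≡ 0
    none = n≤0⇒n≡0 (subst (bads v j c ≤_) (0<ᵇ-false ok) (≤sum (λ j → bads v j c) j))

  0<good⇒fair : ∀ l c → 0 < good l c → ∀ {v} → v ∈ l → Bad v c ≡ false
  0<good⇒fair (w ∷ l) c pos v∈ with Bad w c in eq
  0<good⇒fair (w ∷ l) c pos (here refl) | false = eq
  0<good⇒fair (w ∷ l) c pos (there v∈)  | false =
    0<good⇒fair l c (subst (0 <_) (*-identityˡ _) pos) v∈

  -- Related vertices are joined to v by a walk of length two, and at most d² such walks start at v.
  small : SmallDegree (allFin n)
  small v = begin
    length (filterᵇ (rel v) (allFin n))                    ≡⟨ length-filter-tabulate (rel v) (λ i → i) ⟩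
    count (rel v)                                          ≤⟨ sum-mono (λ w → ⟦0<⟧≤ (count (common v w))) ⟩
    sum (λ w → sum λ x → ⟦ common v w x ⟧)                 ≡⟨ ∑-comm (λ w x → ⟦ common v w x ⟧) ⟩
    sum (λ x → sum λ w → ⟦ common v w x ⟧)                 ≤⟨ sum-mono inner ⟩
    sum (λ x → ⟦ adj G v x ⟧ * d)                          ≡⟨ sym (sum-* (λ x → ⟦ adj G v x ⟧) d) ⟩
    count (adj G v) * d                                    ≤⟨ *-monoˡ-≤ d (deg≤ v) ⟩
    d * d                                                  ∎
    where
    open ≤-Reasoning
    inner : ∀ x → sum (λ w → ⟦ common v w x ⟧) ≤ ⟦ adj G v x ⟧ * d
    inner x with adj G v x
    ... | false = ≤-reflexive (trans (sum-const n 0) (*-zeroʳ n))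
    ... | true  = ≤-trans (count-mono (λ w → adj G w x) (adj G x) λ w → trans (symm G x w))
                          (≤-trans (deg≤ x) (≤-reflexive (sym (*-identityˡ d))))

  Bad-cong : ∀ w c c′ → (∀ i → adj G w i ≡ true → lookup c i ≡ lookup c′ i) → Bad w c ≡ Bad w c′
  Bad-cong w c c′ eq = cong (0 <ᵇ_) (sum-cong-≗ λ j →
    cong (λ o → ⟦ 2 * count (adj G w) <ᵇ m * o ⟧ + ⟦ 8 * m * o <ᵇ count (adj G w) ⟧)
         (occ-cong (adj G w) j c c′ eq))

  -- Unrelated vertices have disjoint neighbourhoods, and whether w is bad depends only on the
  -- labels of its neighbours.
  good-indep : ∀ v l → All (λ w → rel v w ≡ false) l → IndependentOf (adj G v) (good l)
  good-indep v []      []           c c′ eq = refl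
  good-indep v (w ∷ l) (vw ∷ v-l) c c′ eq =
    cong₂ (λ b x → ⟦ not b ⟧ * x) (Bad-cong w c c′ λ i wi → eq i (disjoint i wi))
      (good-indep v l v-l c c′ eq)
    where
    disjoint : ∀ i → adj G w i ≡ true → adj G v i ≡ false
    disjoint i wi with adj G v i in vi
    ... | false = refl
    ... | true = contradiction
      (subst₂ _≤_ (cong ⟦_⟧ (∧-intro vi wi)) (0<ᵇ-false vw) (≤sum (λ x → ⟦ common v w x ⟧) i)) λ ()

  rare : ∀ v l → All (λ w → rel v w ≡ false) l → 4 * Δ * E n (bad∧good v l) ≤ E n (good l)
  -- The factor 4 m is the number of tail events at v.
  rare v l unrel = *-cancelˡ-≤ (4 * m) {{m*n≢0 4 m}} (begin
    4 * m * (4 * Δ * B)                ≡⟨ r₁ m Δ B ⟩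
    16 * Δ * m * B                     ≤⟨ *-monoˡ-≤ B room ⟩
    2 ^ q * B                          ≤⟨ *-monoʳ-≤ (2 ^ q) (E-mono n pt) ⟩
    2 ^ q * E n (λ c → sum λ j → ⟦ tooMany S j c ⟧ * g c + ⟦ tooFew S j c ⟧ * g c)
      ≡⟨ cong (2 ^ q *_) (E-sum n λ j c → ⟦ tooMany S j c ⟧ * g c + ⟦ tooFew S j c ⟧ * g c) ⟩
    2 ^ q * sum (λ j → E n λ c → ⟦ tooMany S j c ⟧ * g c + ⟦ tooFew S j c ⟧ * g c)
      ≡⟨ *-distribˡ-sum (2 ^ q) (λ j → E n λ c → ⟦ tooMany S j c ⟧ * g c + ⟦ tooFew S j c ⟧ * g c) ⟩
    sum (λ j → 2 ^ q * E n λ c → ⟦ tooMany S j c ⟧ * g c + ⟦ tooFew S j c ⟧ * g c)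
      ≤⟨ sum-mono each ⟩
    sum {K} (λ _ → 2 * E n g)          ≡⟨ sum-const K (2 * E n g) ⟩
    2 * m * (2 * E n g)                ≡⟨ r₂ m (E n g) ⟩
    4 * m * E n g                      ∎)
    where
    open ≤-Reasoning
    S = adj G v
    g = good l
    B = E n (bad∧good v l)
    r₁ : ∀ m d x → 4 * m * (4 * d * x) ≡ 16 * d * m * x
    r₁ = solve-∀
    r₂ : ∀ m x → 2 * m * (2 * x) ≡ 4 * m * x
    r₂ = solve-∀
    pt : ∀ c → ⟦ Bad v c ⟧ * g c ≤ sum λ j → ⟦ tooMany S j c ⟧ * g c + ⟦ tooFew S j c ⟧ * g c
    pt c = ≤-trans (*-monoˡ-≤ (g c) (⟦0<⟧≤ (sum λ j → bads v j c)))
      (≤-reflexive (trans (sum-* (λ j → bads v j c) (g c))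
        (sum-cong-≗ λ j → *-distribʳ-+ (g c) ⟦ tooMany S j c ⟧ ⟦ tooFew S j c ⟧)))
    q≤x : q ≤ count S ℕ./ (8 * m)
    q≤x = ≤-trans (≤-reflexive (sym (m*n/n≡m q (8 * m))))
      (/-monoˡ-≤ (8 * m) (≤-trans (≤-reflexive (*-comm q (8 * m))) (deg≥ v)))
    q≤z : q ≤ count S ℕ./ m
    q≤z = ≤-trans q≤x (/-monoʳ-≤ (count S) (m≤n*m m 8))
    each : ∀ j → 2 ^ q * E n (λ c → ⟦ tooMany S j c ⟧ * g c + ⟦ tooFew S j c ⟧ * g c) ≤ 2 * E n g
    each j = begin
      2 ^ q * E n (λ c → ⟦ tooMany S j c ⟧ * g c + ⟦ tooFew S j c ⟧ * g c)
        ≡⟨ trans (cong (2 ^ q *_) (E-+ n _ _)) (*-distribˡ-+ (2 ^ q) _ _) ⟩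
      2 ^ q * E n (λ c → ⟦ tooMany S j c ⟧ * g c) + 2 ^ q * E n (λ c → ⟦ tooFew S j c ⟧ * g c)
        ≤⟨ +-mono-≤ (*-monoˡ-≤ _ (^-monoʳ-≤ 2 q≤z)) (*-monoˡ-≤ _ (^-monoʳ-≤ 2 q≤x)) ⟩
      2 ^ (count S ℕ./ m) * E n (λ c → ⟦ tooMany S j c ⟧ * g c)
        + 2 ^ (count S ℕ./ (8 * m)) * E n (λ c → ⟦ tooFew S j c ⟧ * g c)
        ≤⟨ +-mono-≤ (upper S j g (good-indep v l unrel)) (lower S j g (good-indep v l unrel)) ⟩
      E n g + E n g   ≡⟨ cong (λ x → E n g + x) (sym (+-identityʳ _)) ⟩
      2 * E n g       ∎

-- The order of deletion

sum-δ : ∀ {K} (f : Fin K → ℕ) k → sum (λ j → f j * ⟦ does (k Finₚ.≟ j) ⟧) ≡ f k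
sum-δ {suc K} f zero    = trans (cong₂ _+_ (*-identityʳ (f zero))
  (trans (sum-cong-≗ λ j → *-zeroʳ (f (suc j))) (trans (sum-const K 0) (*-zeroʳ K)))) (+-identityʳ _)
sum-δ {suc K} f (suc k) = cong₂ _+_ (*-zeroʳ (f zero)) (sum-δ (f ∘ suc) k)

count-labels : ∀ {n K} (S : Fin n → Bool) (c : Fin n → Fin K) (P : Fin K → Bool) →
               count (λ w → S w ∧ P (c w)) ≡ sum (λ j → ⟦ P j ⟧ * count (λ w → S w ∧ does (c w Finₚ.≟ j)))
count-labels {n} {K} S c P = begin
  sum (λ w → ⟦ S w ∧ P (c w) ⟧)                                        ≡⟨ sum-cong-≗ pt ⟩
  sum (λ w → sum λ j → ⟦ P j ⟧ * ⟦ S w ∧ does (c w Finₚ.≟ j) ⟧)        ≡⟨ ∑-comm (λ w j → ⟦ P j ⟧ * ⟦ S w ∧ does (c w Finₚ.≟ j) ⟧) ⟩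
  sum (λ j → sum λ w → ⟦ P j ⟧ * ⟦ S w ∧ does (c w Finₚ.≟ j) ⟧)
    ≡⟨ sum-cong-≗ (λ j → sym (*-distribˡ-sum ⟦ P j ⟧ (λ w → ⟦ S w ∧ does (c w Finₚ.≟ j) ⟧))) ⟩
  sum (λ j → ⟦ P j ⟧ * count (λ w → S w ∧ does (c w Finₚ.≟ j)))        ∎
  where
  open ≡-Reasoning
  pt : ∀ w → ⟦ S w ∧ P (c w) ⟧ ≡ sum λ j → ⟦ P j ⟧ * ⟦ S w ∧ does (c w Finₚ.≟ j) ⟧
  pt w with S w
  ... | true  = sym (sum-δ (λ j → ⟦ P j ⟧) (c w))
  ... | false = sym (trans (sum-cong-≗ λ j → *-zeroʳ ⟦ P j ⟧) (trans (sum-const K 0) (*-zeroʳ K)))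

count-disjoint : ∀ {n} (p q r : Fin n → Bool) → (∀ i → p i ≡ true → r i ≡ true) →
                 (∀ i → q i ≡ true → r i ≡ true) → (∀ i → q i ≡ true → p i ≡ false) →
                 count p + count q ≤ count r
count-disjoint p q r p⇒r q⇒r q⇒¬p = ≤-trans (≤-reflexive (sym (∑-distrib-+ (λ i → ⟦ p i ⟧) (λ i → ⟦ q i ⟧))))
  (sum-mono pt)
  where
  pt : ∀ i → ⟦ p i ⟧ + ⟦ q i ⟧ ≤ ⟦ r i ⟧
  pt i with q i in qi
  ... | false = ≤-trans (≤-reflexive (+-identityʳ _)) (⟦⟧-mono {p i} (p⇒r i))
  ... | true rewrite q⇒r i qi | q⇒¬p i qi = ≤-refl

>⇒≤ᵇ-false : ∀ {m n} → n < m → (m ≤ᵇ n) ≡ false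
>⇒≤ᵇ-false {m} {n} lt with m ≤ᵇ n in eq
... | false = refl
... | true  = contradiction (≤ᵇ≡⇒≤ {m} {n} eq) (<⇒≱ lt)

-- The labels below Q mark the late vertices. `R x y` lets early vertices with label x save late
-- ones with label y: `R-many` provides enough savers for every late label, and `R-few` keeps the
-- load of each saver payable.
module Schedule {n} (G : Graph n) (side : Fin n → Bool) (bipartite : ∀ u v → adj G u v ≡ true → side u ≢ side v)
  {K} .{{_ : NonZero K}} (label : Fin n → Fin K) (R : ℕ → ℕ → Bool) (Q M d t : ℕ)
  .{{_ : NonZero Q}} .{{_ : NonZero M}} (K≡MQ : K ≡ M * Q)
  (deg≤ : ∀ v → count (adj G v) ≤ d) (deg≥ : ∀ v → 4 * M * suc t ≤ count (adj G v))
  (atLeast : ∀ v j → count (adj G v) ≤ 4 * K * count (λ w → adj G v w ∧ does (label w Finₚ.≟ j)))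
  (atMost  : ∀ v j → K * count (λ w → adj G v w ∧ does (label w Finₚ.≟ j)) ≤ 4 * count (adj G v))
  (last-many : Q ≤ count (λ (j : Fin K) → toℕ j <ᵇ Q))
  (initial-few : ∀ x → count (λ (j : Fin K) → toℕ j ≤ᵇ x) ≤ suc x)
  (R-many : ∀ y → y < Q → Q ≤ count (λ (j : Fin K) → (Q ≤ᵇ toℕ j) ∧ R (toℕ j) y))
  (R-few  : ∀ x → x < K → 32 * d * (count (λ (j : Fin K) → (toℕ j <ᵇ Q) ∧ R x (toℕ j)) * suc x) ≤ K * K)
  where

  lab : Fin n → ℕ
  lab v = toℕ (label v)

  late : Fin n → Bool
  late v = lab v <ᵇ Q

  -- The side `false` loses its early vertices first, by decreasing label, each
  -- saving the late vertices of the side `true` that R assigns to it; then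
  -- come the early vertices of the side `true`, then all late vertices.
  rankOf : Bool → Bool → ℕ → ℕ
  rankOf false false x = K ∸ x
  rankOf true  false x = 1 + K
  rankOf false true  x = 2 + K
  rankOf true  true  x = 3 + K

  rank : Fin n → ℕ
  rank v = rankOf (side v) (late v) (lab v)

  cand : Fin n → Fin n → Bool
  cand u w = adj G u w ∧ (not (side u) ∧ not (late u) ∧ side w) ∧ (late w ∧ R (lab u) (lab w))

  neighbours≥ : ∀ v (P : Fin K → Bool) →
                count (adj G v) * count P ≤ 4 * K * count (λ w → adj G v w ∧ P (label w))
  neighbours≥ v P = begin
    D * count P                          ≡⟨ *-comm D (count P) ⟩
    count P * D                          ≡⟨ sum-* (λ j → ⟦ P j ⟧) D ⟩
    sum (λ j → ⟦ P j ⟧ * D)              ≤⟨ sum-mono (λ j → *-monoʳ-≤ ⟦ P j ⟧ (atLeast v j)) ⟩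
    sum (λ j → ⟦ P j ⟧ * (4 * K * X j))  ≡⟨ sum-cong-≗ (λ j → r ⟦ P j ⟧ (4 * K) (X j)) ⟩
    sum (λ j → 4 * K * (⟦ P j ⟧ * X j))  ≡⟨ sym (*-distribˡ-sum (4 * K) (λ j → ⟦ P j ⟧ * X j)) ⟩
    4 * K * sum (λ j → ⟦ P j ⟧ * X j)    ≡⟨ cong (4 * K *_) (sym (count-labels (adj G v) label P)) ⟩
    4 * K * count (λ w → adj G v w ∧ P (label w)) ∎
    where
    open ≤-Reasoning
    D = count (adj G v)
    X : Fin K → ℕ
    X j = count (λ w → adj G v w ∧ does (label w Finₚ.≟ j))
    r : ∀ a b c → a * (b * c) ≡ b * (a * c)
    r = solve-∀

  neighbours≤ : ∀ v (P : Fin K → Bool) →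
                K * count (λ w → adj G v w ∧ P (label w)) ≤ 4 * count (adj G v) * count P
  neighbours≤ v P = begin
    K * count (λ w → adj G v w ∧ P (label w)) ≡⟨ cong (K *_) (count-labels (adj G v) label P) ⟩
    K * sum (λ j → ⟦ P j ⟧ * X j)        ≡⟨ *-distribˡ-sum K (λ j → ⟦ P j ⟧ * X j) ⟩
    sum (λ j → K * (⟦ P j ⟧ * X j))      ≡⟨ sum-cong-≗ (λ j → r K ⟦ P j ⟧ (X j)) ⟩
    sum (λ j → ⟦ P j ⟧ * (K * X j))      ≤⟨ sum-mono (λ j → *-monoʳ-≤ ⟦ P j ⟧ (atMost v j)) ⟩
    sum (λ j → ⟦ P j ⟧ * (4 * D))        ≡⟨ sym (sum-* (λ j → ⟦ P j ⟧) (4 * D)) ⟩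
    count P * (4 * D)                    ≡⟨ *-comm (count P) (4 * D) ⟩
    4 * D * count P                      ∎
    where
    open ≤-Reasoning
    D = count (adj G v)
    X : Fin K → ℕ
    X j = count (λ w → adj G v w ∧ does (label w Finₚ.≟ j))
    r : ∀ a b c → a * (b * c) ≡ b * (a * c)
    r = solve-∀

  opposite : ∀ {u v b} → adj G u v ≡ true → side u ≡ b → side v ≡ not b
  opposite {u} {v} {b} uv su with side v in sv
  opposite {u} {v} {true}  uv su | true  = contradiction (trans su (sym sv)) (bipartite u v uv)
  opposite {u} {v} {true}  uv su | false = refl
  opposite {u} {v} {false} uv su | true  = refl
  opposite {u} {v} {false} uv su | false = contradiction (trans su (sym sv)) (bipartite u v uv)

  -- The neighbours w of v with P (label w) are deleted after v or save v.
  module _ (v : Fin n) (P : Fin K → Bool) (P-many : Q ≤ count P)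
    (P-safe : ∀ w → adj G v w ≡ true → P (label w) ≡ true →
              (rank w ≤ᵇ rank v) ∧ not (cand w v) ≡ false) where

    -- With D neighbours in all, at least D / (4 K) carry any given label, so the Q or more labels
    -- in P account for D / (4 M) ≥ t + 1 of them.
    suc-t≤ : suc t ≤ count (λ w → adj G v w ∧ P (label w))
    suc-t≤ = *-cancelˡ-≤ (4 * M * Q) {{m*n≢0 (4 * M) Q {{m*n≢0 4 M}}}} (begin
      4 * M * Q * suc t                 ≡⟨ r₁ M Q (suc t) ⟩
      4 * M * suc t * Q                 ≤⟨ *-mono-≤ (deg≥ v) P-many ⟩
      count (adj G v) * count P         ≤⟨ neighbours≥ v P ⟩
      4 * K * X                         ≡⟨ cong (λ k → 4 * k * X) K≡MQ ⟩
      4 * (M * Q) * X                   ≡⟨ r₂ M Q X ⟩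
      4 * M * Q * X                     ∎)
      where
      open ≤-Reasoning
      X = count (λ w → adj G v w ∧ P (label w))
      r₁ : ∀ m q s → 4 * m * q * s ≡ 4 * m * s * q
      r₁ = solve-∀
      r₂ : ∀ m q s → 4 * (m * q) * s ≡ 4 * m * q * s
      r₂ = solve-∀

    enough-safe : suc (unsaved G rank cand v) + t ≤ count (adj G v)
    enough-safe = ≤-trans (≤-reflexive (sym (+-suc _ t))) (≤-trans (+-monoʳ-≤ _ suc-t≤)
      (count-disjoint (isUnsaved G rank cand v) (λ w → adj G v w ∧ P (label w)) (adj G v)
        (λ w → proj₁ ∘ ∧-elim) (λ w → proj₁ ∘ ∧-elim) q⇒¬p))
      where
      q⇒¬p : ∀ w → adj G v w ∧ P (label w) ≡ true → isUnsaved G rank cand v w ≡ false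
      q⇒¬p w eq with ∧-elim {adj G v w} eq
      ... | vw , Pw = trans (cong (adj G v w ∧_) (P-safe w vw Pw)) (∧-zeroʳ (adj G v w))

  -- For a late vertex on the side `true`, the safe neighbours are the early ones that R assigns to
  -- it. For all other vertices they are the late neighbours, whose rank is strictly larger.
  enough-all : ∀ v → suc (unsaved G rank cand v) + t ≤ count (adj G v)
  enough-all v = by (side v) (late v) refl refl
    where
    by : ∀ s l → side v ≡ s → late v ≡ l → suc (unsaved G rank cand v) + t ≤ count (adj G v)
    by true true sv lv = enough-safe v (λ j → (Q ≤ᵇ toℕ j) ∧ R (toℕ j) (lab v))
      (R-many (lab v) (<ᵇ≡⇒< lv)) λ w vw Pw → saved w vw Pw
      where
      saved : ∀ w → adj G v w ≡ true → (Q ≤ᵇ lab w) ∧ R (lab w) (lab v) ≡ true →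
              (rank w ≤ᵇ rank v) ∧ not (cand w v) ≡ false
      saved w vw Pw rewrite trans (symm G w v) vw | opposite vw sv | sv | lv
        | proj₂ (∧-elim {Q ≤ᵇ lab w} Pw) with late w in lw
      ... | false = ∧-zeroʳ _
      ... | true  = contradiction (≤ᵇ≡⇒≤ {Q} {lab w} (proj₁ (∧-elim {Q ≤ᵇ lab w} Pw))) (<⇒≱ (<ᵇ≡⇒< {lab w} lw))
    by true false sv lv = enough-safe v (λ j → toℕ j <ᵇ Q) last-many later
      where
      later : ∀ w → adj G v w ≡ true → late w ≡ true → (rank w ≤ᵇ rank v) ∧ not (cand w v) ≡ false
      later w vw lw = cong (_∧ not (cand w v)) (>⇒≤ᵇ-false rank<)
        where
        rank< : rank v < rank w
        rank< rewrite sv | lv | opposite vw sv | lw = ≤-refl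
    by false b sv lv = enough-safe v (λ j → toℕ j <ᵇ Q) last-many later
      where
      later : ∀ w → adj G v w ≡ true → late w ≡ true → (rank w ≤ᵇ rank v) ∧ not (cand w v) ≡ false
      later w vw lw = cong (_∧ not (cand w v)) (>⇒≤ᵇ-false (rank< b lv))
        where
        rank< : ∀ b → late v ≡ b → rank v < rank w
        rank< false lv rewrite sv | lv | opposite vw sv | lw = s≤s (≤-trans (m∸n≤m K (lab v)) (m≤n+m K 2))
        rank< true  lv rewrite sv | lv | opposite vw sv | lw = ≤-refl

  module _ (u : Fin n) (su : side u ≡ false) (lu : late u ≡ false) where

    D h : ℕ
    D = count (adj G u)
    h = count (λ (j : Fin K) → (toℕ j <ᵇ Q) ∧ R (lab u) (toℕ j))

    rank-u : rank u ≡ K ∸ lab u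
    rank-u rewrite su | lu = refl

    -- All neighbours of u are on the side `true`, where every rank exceeds K.
    earlier≡0 : earlier G rank u ≡ 0
    earlier≡0 = count-none (isEarlier G rank u) pt
      where
      pt : ∀ w → isEarlier G rank u w ≡ false
      pt w with adj G u w in uw
      ... | false = refl
      ... | true  = >⇒≤ᵇ-false (subst (_< rank w) (sym rank-u) (≤-trans (s≤s (m∸n≤m K (lab u))) (K<rank (late w) refl)))
        where
        K<rank : ∀ b → late w ≡ b → K < rank w
        K<rank b lw rewrite opposite uw su | lw with b
        ... | false = ≤-refl
        ... | true  = s≤s (m≤n+m K 2)

    -- Neighbours of w not deleted before u have labels at most `lab u`: the early ones because
    -- labels decrease in the course of deletion, the late ones because their labels are below Q ≤
    -- `lab u`.
    K*between≤ : ∀ w → cand u w ≡ true → K * between G rank u w ≤ 4 * d * suc (lab u)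
    K*between≤ w cw = begin
      K * between G rank u w
        ≤⟨ *-monoʳ-≤ K (count-mono (isBetween G rank u w) (λ x → adj G w x ∧ (lab x ≤ᵇ lab u)) small-label) ⟩
      K * count (λ x → adj G w x ∧ (lab x ≤ᵇ lab u))
        ≤⟨ neighbours≤ w (λ j → toℕ j ≤ᵇ lab u) ⟩
      4 * count (adj G w) * count (λ (j : Fin K) → toℕ j ≤ᵇ lab u)
        ≤⟨ *-mono-≤ (*-monoʳ-≤ 4 (deg≤ w)) (initial-few (lab u)) ⟩
      4 * d * suc (lab u) ∎
      where
      open ≤-Reasoning
      sw : side w ≡ true
      sw = opposite (proj₁ (∧-elim cw)) su
      small-label : ∀ x → isBetween G rank u w x ≡ true → adj G w x ∧ (lab x ≤ᵇ lab u) ≡ true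
      small-label x eq with ∧-elim {adj G w x} eq
      ... | wx , eq′ = ∧-intro wx (≤⇒≤ᵇ≡ (go (late x) refl (≤ᵇ≡⇒≤ {rank u} (proj₁ (∧-elim eq′)))))
        where
        go : ∀ b → late x ≡ b → rank u ≤ rank x → lab x ≤ lab u
        go true  lx _ = ≤-trans (<⇒≤ (<ᵇ≡⇒< {lab x} {Q} lx)) (<ᵇ-false {lab u} {Q} lu)
        go false lx le rewrite rank-u | opposite wx sw | lx = ≮⇒≥ λ lt → <⇒≱ (∸-monoʳ-< lt (<⇒≤ (Finₚ.toℕ<n (label x)))) le

    K*cands≤ : K * count (cand u) ≤ 4 * D * h
    K*cands≤ = ≤-trans (*-monoʳ-≤ K (count-mono (cand u) (λ w → adj G u w ∧ ((lab w <ᵇ Q) ∧ R (lab u) (lab w)))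
        λ w eq → let a , b = ∧-elim {adj G u w} eq
                 in ∧-intro a (proj₂ (∧-elim {not (side u) ∧ not (late u) ∧ side w} b))))
      (neighbours≤ u (λ j → (toℕ j <ᵇ Q) ∧ R (lab u) (toℕ j)))

    -- With x = `lab u`, at most 4 D h / K candidates cost at most 4 d (x + 1) / K each. Twice the
    -- load is thus at most D times 32 d h (x + 1) / K², a factor that `R-few` bounds by 1.
    2*load≤ : 2 * load G rank cand u ≤ D
    2*load≤ = *-cancelˡ-≤ (K * K) {{m*n≢0 K K}} (begin
      K * K * (2 * load G rank cand u)                  ≡⟨ r₁ K (load G rank cand u) ⟩
      2 * K * (K * load G rank cand u)                  ≤⟨ *-monoʳ-≤ (2 * K) K*load≤ ⟩
      2 * K * (count (cand u) * (4 * d * suc (lab u)))  ≡⟨ r₂ K (count (cand u)) d (suc (lab u)) ⟩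
      K * count (cand u) * (8 * d * suc (lab u))        ≤⟨ *-monoˡ-≤ _ K*cands≤ ⟩
      4 * D * h * (8 * d * suc (lab u))                 ≡⟨ r₃ D h d (suc (lab u)) ⟩
      32 * d * (h * suc (lab u)) * D                    ≤⟨ *-monoˡ-≤ D (R-few (lab u) (Finₚ.toℕ<n (label u))) ⟩
      K * K * D                                         ∎)
      where
      open ≤-Reasoning
      r₁ : ∀ k l → k * k * (2 * l) ≡ 2 * k * (k * l)
      r₁ = solve-∀
      r₂ : ∀ k c d l → 2 * k * (c * (4 * d * l)) ≡ k * c * (8 * d * l)
      r₂ = solve-∀
      r₃ : ∀ D h d l → 4 * D * h * (8 * d * l) ≡ 32 * d * (h * l) * D
      r₃ = solve-∀
      r₄ : ∀ k a b → k * (a * b) ≡ a * (k * b)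
      r₄ = solve-∀
      K*load≤ : K * load G rank cand u ≤ count (cand u) * (4 * d * suc (lab u))
      K*load≤ = begin
        K * load G rank cand u                                 ≡⟨ *-distribˡ-sum K (λ w → ⟦ cand u w ⟧ * between G rank u w) ⟩
        sum (λ w → K * (⟦ cand u w ⟧ * between G rank u w))    ≤⟨ sum-mono pt ⟩
        sum (λ w → ⟦ cand u w ⟧ * (4 * d * suc (lab u)))       ≡⟨ sym (sum-* (λ w → ⟦ cand u w ⟧) _) ⟩
        count (cand u) * (4 * d * suc (lab u))                 ∎
        where
        pt : ∀ w → K * (⟦ cand u w ⟧ * between G rank u w) ≤ ⟦ cand u w ⟧ * (4 * d * suc (lab u))
        pt w with cand u w in cw
        ... | false = ≤-reflexive (*-zeroʳ K)
        ... | true  = ≤-trans (≤-reflexive (r₄ K 1 (between G rank u w)))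
                              (*-monoʳ-≤ 1 (K*between≤ w cw))

    -- One half of D pays for the load; the other half is at least t + 1 since D ≥ 4 M (t + 1).
    payable-early : suc (earlier G rank u + load G rank cand u) + t ≤ D
    payable-early rewrite earlier≡0 = *-cancelˡ-≤ 2 (begin
      2 * (suc l + t)         ≡⟨ r l t ⟩
      2 * l + 2 * suc t       ≤⟨ +-mono-≤ 2*load≤ (≤-trans (*-monoˡ-≤ (suc t) 2≤4M) (deg≥ u)) ⟩
      D + D                   ≡⟨ cong (λ x → D + x) (sym (+-identityʳ D)) ⟩
      2 * D                   ∎)
      where
      open ≤-Reasoning
      l = load G rank cand u
      r : ∀ l t → 2 * (suc l + t) ≡ 2 * l + 2 * suc t
      r = solve-∀
      2≤4M : 2 ≤ 4 * M
      2≤4M = ≤-trans (s≤s (s≤s z≤n)) (*-monoʳ-≤ 4 (>-nonZero⁻¹ M))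

  payable-all : ∀ u → (∀ w → cand u w ≡ false) ⊎
                suc (earlier G rank u + load G rank cand u) + t ≤ count (adj G u)
  payable-all u = by (side u) (late u) refl refl
    where
    by : ∀ s l → side u ≡ s → late u ≡ l → (∀ w → cand u w ≡ false) ⊎
         suc (earlier G rank u + load G rank cand u) + t ≤ count (adj G u)
    by false false su lu = inj₂ (payable-early u su lu)
    by true  l     su lu = inj₁ λ w →
      trans (cong (λ s → adj G u w ∧ (not s ∧ not (late u) ∧ side w) ∧ (late w ∧ R (lab u) (lab w))) su)
            (∧-zeroʳ (adj G u w))
    by false true  su lu = inj₁ λ w →
      trans (cong₂ (λ s l → adj G u w ∧ (not s ∧ not l ∧ side w) ∧ (late w ∧ R (lab u) (lab w))) su lu)
            (∧-zeroʳ (adj G u w))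

  plan : ∀ k → k ℤ.≤ + t → Plan G (λ v → + deg G v ℤ.- k) rank cand
  plan k k≤t = record
    { cand⇒adj = λ u w → proj₁ ∘ ∧-elim
    ; enough   = λ v → shift v (enough-all v)
    ; payable  = λ u → pay u (payable-all u)
    }
    where
    shift : ∀ v {m} → m + t ≤ count (adj G v) → + m ℤ.≤ + deg G v ℤ.- k
    shift v {m} le = begin
      + m                               ≡⟨ sym (ℤₚ.+-identityʳ (+ m)) ⟩
      + m ℤ.+ + 0                       ≡⟨ cong (λ x → + m ℤ.+ x) (sym (ℤₚ.+-inverseʳ (+ t))) ⟩
      + m ℤ.+ (+ t ℤ.- + t)             ≡⟨ sym (ℤₚ.+-assoc (+ m) (+ t) (ℤ.- + t)) ⟩
      + (m + t) ℤ.- + t                 ≤⟨ ℤₚ.+-mono-≤ (ℤ.+≤+ le) (ℤₚ.neg-mono-≤ k≤t) ⟩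
      + count (adj G v) ℤ.- k           ≡⟨ cong (λ x → + x ℤ.- k) (sym (count≡∣tabulate∣ (adj G v))) ⟩
      + deg G v ℤ.- k                   ∎
      where open ℤₚ.≤-Reasoning
    pay : ∀ u → (∀ w → cand u w ≡ false) ⊎
          suc (earlier G rank u + load G rank cand u) + t ≤ count (adj G u) →
          (∀ w → cand u w ≡ false) ⊎ + suc (earlier G rank u + load G rank cand u) ℤ.≤ + deg G u ℤ.- k
    pay u (inj₁ none) = inj₁ none
    pay u (inj₂ le)   = inj₂ (shift u le)

-- Counting in intervals and residue classes

countBelow : ℕ → (ℕ → Bool) → ℕ
countBelow n P = count (λ (j : Fin n) → P (toℕ j))

countBelow-+ : ∀ a b P → countBelow (a + b) P ≡ countBelow a P + countBelow b (λ x → P (a + x))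
countBelow-+ zero    b P = refl
countBelow-+ (suc a) b P = trans (cong (λ x → ⟦ P 0 ⟧ + x) (countBelow-+ a b (P ∘ suc)))
  (sym (+-assoc ⟦ P 0 ⟧ _ _))

countBelow-mono : ∀ n P P′ → (∀ x → x < n → P x ≡ true → P′ x ≡ true) → countBelow n P ≤ countBelow n P′
countBelow-mono n P P′ P⇒P′ = count-mono (P ∘ toℕ) (P′ ∘ toℕ) λ j → P⇒P′ (toℕ j) (Finₚ.toℕ<n j)

countBelow-cong : ∀ n {P P′} → (∀ x → P x ≡ P′ x) → countBelow n P ≡ countBelow n P′
countBelow-cong n eq = sum-cong-≗ {n} λ j → cong ⟦_⟧ (eq (toℕ j))

countBelow≤ : ∀ n P → countBelow n P ≤ n
countBelow≤ n P = ≤-trans (sum-mono {n} {g = λ _ → 1} λ j → ⟦⟧≤1 (P (toℕ j)))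
  (≤-reflexive (trans (sum-const n 1) (*-identityʳ n)))
  where
  ⟦⟧≤1 : ∀ b → ⟦ b ⟧ ≤ 1
  ⟦⟧≤1 true  = ≤-refl
  ⟦⟧≤1 false = z≤n

window≤countBelow : ∀ n a b P → a + b ≤ n → countBelow b (λ x → P (a + x)) ≤ countBelow n P
window≤countBelow n a b P le = begin
  countBelow b (λ x → P (a + x))                    ≤⟨ m≤n+m _ _ ⟩
  countBelow a P + countBelow b (λ x → P (a + x))   ≡⟨ sym (countBelow-+ a b P) ⟩
  countBelow (a + b) P                              ≤⟨ m≤m+n _ _ ⟩
  countBelow (a + b) P + countBelow (n ∸ (a + b)) (λ x → P (a + b + x))
                                                    ≡⟨ sym (countBelow-+ (a + b) (n ∸ (a + b)) P) ⟩
  countBelow (a + b + (n ∸ (a + b))) P              ≡⟨ cong (λ k → countBelow k P) (m+[n∸m]≡n le) ⟩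
  countBelow n P                                    ∎
  where open ≤-Reasoning

countBelow≤window : ∀ n a b P → (∀ x → P x ≡ true → a ≤ x × x < a + b) →
                    countBelow n P ≤ countBelow b (λ x → P (a + x))
countBelow≤window n a b P inside = begin
  -- The range is enlarged by a + b so that it contains the window whether or not n reaches that
  -- far.
  countBelow n P                                     ≤⟨ m≤m+n _ _ ⟩
  countBelow n P + countBelow (a + b) (λ x → P (n + x)) ≡⟨ sym (countBelow-+ n (a + b) P) ⟩
  countBelow (n + (a + b)) P                         ≡⟨ cong (λ k → countBelow k P) (+-comm n (a + b)) ⟩
  countBelow (a + b + n) P                           ≡⟨ countBelow-+ (a + b) n P ⟩
  countBelow (a + b) P + countBelow n (λ x → P (a + b + x))
    ≡⟨ cong₂ _+_ (countBelow-+ a b P) (count-none (λ (j : Fin n) → P (a + b + toℕ j)) λ j → outside (λ lt → <⇒≱ (proj₂ lt) (m≤m+n (a + b) (toℕ j)))) ⟩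
  countBelow a P + countBelow b (λ x → P (a + x)) + 0 ≡⟨ +-identityʳ _ ⟩
  countBelow a P + countBelow b (λ x → P (a + x))
    ≡⟨ cong (λ k → k + countBelow b (λ x → P (a + x)))
         (count-none (λ (j : Fin a) → P (toℕ j)) λ j → outside (λ lt → <⇒≱ (Finₚ.toℕ<n j) (proj₁ lt))) ⟩
  countBelow b (λ x → P (a + x))                     ∎
  where
  open ≤-Reasoning
  outside : ∀ {x} → ¬ (a ≤ x × x < a + b) → P x ≡ false
  outside {x} out with P x in eq
  ... | false = refl
  ... | true  = contradiction (inside x eq) out

countBelow-all : ∀ n P → (∀ x → x < n → P x ≡ true) → countBelow n P ≡ n
countBelow-all n P all = trans (sum-cong-≗ λ j → cong ⟦_⟧ (all (toℕ j) (Finₚ.toℕ<n j)))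
  (trans (sum-const n 1) (*-identityʳ n))

-- Shifting a window of length m by one drops position 0 and gains position m.
slide : ∀ m P → P m ≡ P 0 → countBelow m (P ∘ suc) ≡ countBelow m P
slide m P eq = +-cancelˡ-≡ ⟦ P 0 ⟧ _ _ (begin
  countBelow (suc m) P                              ≡⟨ cong (λ k → countBelow k P) (+-comm 1 m) ⟩
  countBelow (m + 1) P                              ≡⟨ countBelow-+ m 1 P ⟩
  countBelow m P + (⟦ P (m + 0) ⟧ + 0)              ≡⟨ cong (λ x → countBelow m P + x) (trans (+-identityʳ _) (cong (λ x → ⟦ P x ⟧) (+-identityʳ m))) ⟩
  countBelow m P + ⟦ P m ⟧                          ≡⟨ cong (λ b → countBelow m P + ⟦ b ⟧) eq ⟩
  countBelow m P + ⟦ P 0 ⟧                          ≡⟨ +-comm _ ⟦ P 0 ⟧ ⟩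
  ⟦ P 0 ⟧ + countBelow m P                          ∎)
  where open ≡-Reasoning

module Residue (m : ℕ) .{{_ : NonZero m}} (r : ℕ) (r<m : r < m) where

  P : ℕ → Bool
  P x = x ℕ.% m ≡ᵇ r

  periodic : ∀ x → P (m + x) ≡ P x
  periodic x = cong (_≡ᵇ r) (trans (cong (ℕ._% m) (+-comm m x)) ([m+n]%n≡m%n x m))

  one-period : countBelow m P ≡ 1
  one-period = trans (sum-cong-≗ pt) (count-≟ k)
    where
    k = fromℕ< r<m
    pt : ∀ j → ⟦ P (toℕ j) ⟧ ≡ ⟦ does (j Finₚ.≟ k) ⟧
    pt j with j Finₚ.≟ k | P (toℕ j) in eq
    ... | yes _  | true  = refl
    ... | no _   | false = refl
    ... | yes refl | false = contradiction (trans (sym eq) (Equivalence.to T-≡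
            (≡⇒≡ᵇ _ _ (trans (m<n⇒m%n≡m (Finₚ.toℕ<n j)) (Finₚ.toℕ-fromℕ< r<m))))) λ ()
    ... | no j≢k | true  = contradiction (Finₚ.toℕ-injective (begin
            toℕ j        ≡⟨ sym (m<n⇒m%n≡m (Finₚ.toℕ<n j)) ⟩
            toℕ j ℕ.% m    ≡⟨ ≡ᵇ⇒≡ _ _ (Equivalence.from T-≡ eq) ⟩
            r            ≡⟨ sym (Finₚ.toℕ-fromℕ< r<m) ⟩
            toℕ k        ∎)) j≢k
      where open ≡-Reasoning

  any-period : ∀ a → countBelow m (λ x → P (a + x)) ≡ 1
  any-period zero    = one-period
  any-period (suc a) = trans (countBelow-cong m λ x → cong P (sym (+-suc a x)))
    (trans (slide m (λ x → P (a + x)) (trans (cong P (+-comm a m)) (trans (periodic a) (cong P (sym (+-identityʳ a))))))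
           (any-period a))

  count-residue : ∀ L a → countBelow (L * m) (λ x → P (a + x)) ≡ L
  count-residue zero    a = refl
  count-residue (suc L) a = trans (countBelow-+ m (L * m) (λ x → P (a + x)))
    (cong₂ _+_ (any-period a) (trans (countBelow-cong (L * m) λ x → cong P (sym (+-assoc a m x)))
      (count-residue L (a + m))))

-- The dyadic assignment of savers

2^≢0 : ∀ i → NonZero (2 ^ i)
2^≢0 i = m^n≢0 2 i

infixl 7 _/2^_ _%2^_

_/2^_ _%2^_ : ℕ → ℕ → ℕ
x /2^ i = (x ℕ./ 2 ^ i) {{2^≢0 i}}
x %2^ i = (x ℕ.% 2 ^ i) {{2^≢0 i}}

-- Read y < I * 2 ^ I as a pair (i , r) with i < I and r < 2 ^ I.  Then y is
-- assigned to the x in the dyadic block [Q 2 ^ i , Q 2 ^ (i + 1)) that agree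
-- with r modulo 2 ^ i, that is, to a fraction 2 ^ - i of this block.
module Assignment (I Q : ℕ) .{{_ : NonZero Q}} where

  block : ℕ → ℕ
  block y = y /2^ I

  R : ℕ → ℕ → Bool
  R x y = (Q * 2 ^ block y ≤ᵇ x) ∧ (x <ᵇ Q * 2 ^ suc (block y)) ∧ (x %2^ block y ≡ᵇ y %2^ block y)

  -- With i = `block y`, the dyadic block consists of Q 2 ^ i numbers, exactly Q of which are in the
  -- required class modulo 2 ^ i. It ends by Q 2 ^ I ≤ K because i < I.
  R-many : ∀ {K} → Q * 2 ^ I ≤ K → ∀ y → y < I * 2 ^ I → Q ≤ countBelow K (λ x → (Q ≤ᵇ x) ∧ R x y)
  R-many {K} Q2^I≤K y y< = begin
    Q                                              ≡⟨ sym (Residue.count-residue (2 ^ i) {{2^≢0 i}} (y %2^ i) (m%n<n y (2 ^ i) {{2^≢0 i}}) Q a) ⟩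
    countBelow b (λ x → (a + x) %2^ i ≡ᵇ y %2^ i)
      ≤⟨ countBelow-mono b _ (λ x → (Q ≤ᵇ a + x) ∧ R (a + x) y) (λ x x<b eq →
           ∧-intro (≤⇒≤ᵇ≡ (≤-trans (m≤m*n Q (2 ^ i) {{2^≢0 i}}) (m≤m+n a x)))
           (∧-intro (≤⇒≤ᵇ≡ (m≤m+n a x))
           (∧-intro (Equivalence.to T-≡ (<⇒<ᵇ (<-≤-trans (+-monoʳ-< a x<b) (≤-reflexive a+b)))) eq))) ⟩
    countBelow b (λ x → (Q ≤ᵇ a + x) ∧ R (a + x) y)
      ≤⟨ window≤countBelow K a b (λ x → (Q ≤ᵇ x) ∧ R x y)
           (≤-trans (≤-reflexive a+b) (≤-trans (*-monoʳ-≤ Q (^-monoʳ-≤ 2 (m<n*o⇒m/o<n {y} {I} {2 ^ I} {{2^≢0 I}} y<))) Q2^I≤K)) ⟩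
    countBelow K (λ x → (Q ≤ᵇ x) ∧ R x y)          ∎
    where
    open ≤-Reasoning
    i = block y
    a = Q * 2 ^ i
    b = Q * 2 ^ i
    a+b : a + b ≡ Q * 2 ^ suc i
    a+b = r Q (2 ^ i)
      where
      r : ∀ q p → q * p + q * p ≡ q * (2 * p)
      r = solve-∀

  R⇒ : ∀ {x y} → R x y ≡ true →
       Q * 2 ^ block y ≤ x × x < Q * 2 ^ suc (block y) × x %2^ block y ≡ y %2^ block y
  R⇒ {x} {y} eq with ∧-elim {Q * 2 ^ block y ≤ᵇ x} eq
  ... | lo , eq′ with ∧-elim {x <ᵇ Q * 2 ^ suc (block y)} eq′
  ...   | hi , res = ≤ᵇ≡⇒≤ lo , <ᵇ≡⇒< {x} hi , ≡ᵇ⇒≡ _ _ (Equivalence.from T-≡ res)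

  block-≤ : ∀ {x y y′} → R x y ≡ true → R x y′ ≡ true → block y ≤ block y′
  block-≤ {x} {y} {y′} Rxy Rxy′ = ≮⇒≥ λ lt → <⇒≱ (proj₁ (proj₂ (R⇒ {x} {y′} Rxy′)))
    (≤-trans (*-monoʳ-≤ Q (^-monoʳ-≤ 2 lt)) (proj₁ (R⇒ {x} {y} Rxy)))

  -- Dyadic blocks are disjoint, so all y assigned to x share one i. Of the 2 ^ I numbers y with
  -- that i, the congruence leaves 2 ^ (I - i), while x < Q 2 ^ (i + 1). The powers 2 ^ i cancel,
  -- which gives the same bound at every scale.
  R-few : ∀ K x → countBelow K (λ y → (y <ᵇ I * 2 ^ I) ∧ R x y) * suc x ≤ 2 * Q * 2 ^ I
  R-few K x with countBelow K (λ y → (y <ᵇ I * 2 ^ I) ∧ R x y) in eq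
  ... | zero  = z≤n
  ... | suc h = subst (λ h → h * suc x ≤ 2 * Q * 2 ^ I) eq bound
    where
    P : ℕ → Bool
    P y = (y <ᵇ I * 2 ^ I) ∧ R x y
    witness : ∃[ y ] P y ≡ true
    witness = let j , pos = sum>0 {f = λ (j : Fin K) → ⟦ P (toℕ j) ⟧} (subst (0 <_) (sym eq) (s≤s z≤n))
              in toℕ j , 0<⟦⟧ (P (toℕ j)) pos
      where
      0<⟦⟧ : ∀ b → 0 < ⟦ b ⟧ → b ≡ true
      0<⟦⟧ true _ = refl
    y₀ = proj₁ witness
    Rxy₀ : R x y₀ ≡ true
    Rxy₀ = proj₂ (∧-elim {y₀ <ᵇ I * 2 ^ I} (proj₂ witness))
    i = block y₀
    i<I : i < I
    i<I = m<n*o⇒m/o<n {y₀} {I} {2 ^ I} {{2^≢0 I}} (<ᵇ≡⇒< (proj₁ (∧-elim {y₀ <ᵇ I * 2 ^ I} (proj₂ witness))))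
    L = 2 ^ (I ∸ i)
    L* : L * 2 ^ i ≡ 2 ^ I
    L* = trans (sym (^-distribˡ-+-* 2 (I ∸ i) i)) (cong (2 ^_) (m∸n+n≡m (<⇒≤ i<I)))
    same : ∀ y → P y ≡ true → block y ≡ i
    same y Py = let Rxy = proj₂ (∧-elim {y <ᵇ I * 2 ^ I} Py) in
      ≤-antisym (block-≤ {x} {y} {y₀} Rxy Rxy₀) (block-≤ {x} {y₀} {y} Rxy₀ Rxy)
    inside : ∀ y → P y ≡ true → i * 2 ^ I ≤ y × y < i * 2 ^ I + 2 ^ I
    inside y Py = subst (λ i → i * 2 ^ I ≤ y × y < i * 2 ^ I + 2 ^ I) (same y Py)
      ( m/n*n≤m y (2 ^ I) {{2^≢0 I}}
      , subst₂ _<_ (sym (trans (m≡m%n+[m/n]*n y (2 ^ I) {{2^≢0 I}}) (+-comm (y %2^ I) _))) refl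
          (+-monoʳ-< (y /2^ I * 2 ^ I) (m%n<n y (2 ^ I) {{2^≢0 I}})))
    residue : ∀ y → P y ≡ true → (y %2^ i ≡ᵇ x %2^ i) ≡ true
    residue y Py = Equivalence.to T-≡ (≡⇒≡ᵇ _ _ (sym (subst (λ i → x %2^ i ≡ y %2^ i) (same y Py)
      (proj₂ (proj₂ (R⇒ {x} {y} (proj₂ (∧-elim {y <ᵇ I * 2 ^ I} Py))))))))
    open ≤-Reasoning
    h≤ : countBelow K P ≤ L
    h≤ = begin
      countBelow K P                                         ≤⟨ countBelow≤window K (i * 2 ^ I) (2 ^ I) P inside ⟩
      countBelow (2 ^ I) (λ z → P (i * 2 ^ I + z))           ≤⟨ countBelow-mono (2 ^ I) _ _ (λ z _ → residue (i * 2 ^ I + z)) ⟩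
      countBelow (2 ^ I) (λ z → (i * 2 ^ I + z) %2^ i ≡ᵇ x %2^ i)
        ≡⟨ cong (λ n → countBelow n (λ z → (i * 2 ^ I + z) %2^ i ≡ᵇ x %2^ i)) (sym L*) ⟩
      countBelow (L * 2 ^ i) (λ z → (i * 2 ^ I + z) %2^ i ≡ᵇ x %2^ i)
        ≡⟨ Residue.count-residue (2 ^ i) {{2^≢0 i}} (x %2^ i) (m%n<n x (2 ^ i) {{2^≢0 i}}) L (i * 2 ^ I) ⟩
      L                                                      ∎
    bound : countBelow K P * suc x ≤ 2 * Q * 2 ^ I
    bound = begin
      countBelow K P * suc x     ≤⟨ *-mono-≤ h≤ (proj₁ (proj₂ (R⇒ {x} {y₀} Rxy₀))) ⟩
      L * (Q * (2 * 2 ^ i))      ≡⟨ r L Q (2 ^ i) ⟩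
      2 * Q * (L * 2 ^ i)        ≡⟨ cong (2 * Q *_) L* ⟩
      2 * Q * 2 ^ I              ∎
      where
      r : ∀ l q p → l * (q * (2 * p)) ≡ 2 * q * (l * p)
      r = solve-∀

-- With I = `suc J`, the condition 2 ^ I ≤ M makes all I dyadic blocks fit among the K labels, 64 d
-- ≤ M² I yields the `R-few` of `Schedule`, and the two inequalities on q are those of `splitting`.
removable : ∀ {n} (G : Graph n) (d δ t q M J : ℕ) .{{_ : NonZero M}} .{{_ : NonZero d}} → Bipartite G →
            (∀ v → deg G v ≤ d) → (∀ v → δ ≤ deg G v) →
            4 * M * suc t ≤ δ → 64 * d ≤ M * M * suc J → 2 ^ suc J ≤ M →
            8 * (M * (suc J * 2 ^ J)) * q ≤ δ → 16 * (d * d) * (M * (suc J * 2 ^ J)) ≤ 2 ^ q →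
            ∀ k → k ℤ.≤ + t → Removable G (λ v → + deg G v ℤ.- k)
removable {n} G d δ t q M J (side , bip) deg≤ deg≥ δ≥ M²I≥ 2^I≤M few-labels room k k≤t =
  plan⇒removable (Schedule.plan G side bip label R Q M d t K≡MQ deg≤′ (λ v → ≤-trans δ≥ (deg≥′ v))
    (λ v j → ≤-trans (proj₁ (fair v j)) (≤-reflexive (cong (_* count (λ w → adj G v w ∧ does (label w Finₚ.≟ j))) (r₁ m))))
    (λ v j → ≤-trans (≤-reflexive (*-assoc 2 m _)) (≤-trans (*-monoʳ-≤ 2 (proj₂ (fair v j))) (≤-reflexive (r₂ (count (adj G v))))))
    last-many initial-few (R-many Q2^I≤K) few k k≤t)
  where
  I = suc J
  Q = I * 2 ^ I
  -- Half of M Q, since `splitting` produces 2 m labels; this is why the power is 2 ^ J instead of 2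
  -- ^ I.
  m = M * (I * 2 ^ J)
  K = 2 * m
  instance
    Q≢0 : NonZero Q
    Q≢0 = m*n≢0 I (2 ^ I) {{it}} {{2^≢0 I}}
    m≢0 : NonZero m
    m≢0 = m*n≢0 M (I * 2 ^ J) {{it}} {{m*n≢0 I (2 ^ J) {{it}} {{2^≢0 J}}}}
    K≢0 : NonZero K
    K≢0 = m*n≢0 2 m
  open Assignment I Q
  r₁ : ∀ m → 8 * m ≡ 4 * (2 * m)
  r₁ = solve-∀
  r₂ : ∀ x → 2 * (2 * x) ≡ 4 * x
  r₂ = solve-∀
  K≡MQ : K ≡ M * Q
  K≡MQ = r M I (2 ^ J)
    where
    r : ∀ m i p → 2 * (m * (i * p)) ≡ m * (i * (2 * p))
    r = solve-∀
  deg≤′ : ∀ v → count (adj G v) ≤ d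
  deg≤′ v = subst (_≤ d) (count≡∣tabulate∣ (adj G v)) (deg≤ v)
  deg≥′ : ∀ v → δ ≤ count (adj G v)
  deg≥′ v = subst (δ ≤_) (count≡∣tabulate∣ (adj G v)) (deg≥ v)
  labelling = splitting G m d q deg≤′ (λ v → ≤-trans few-labels (deg≥′ v)) room
  label = proj₁ labelling
  fair = proj₂ labelling
  Q≤K : Q ≤ K
  Q≤K = ≤-trans (m≤n*m Q M) (≤-reflexive (sym K≡MQ))
  Q2^I≤K : Q * 2 ^ I ≤ K
  Q2^I≤K = ≤-trans (*-monoʳ-≤ Q 2^I≤M) (≤-reflexive (trans (*-comm Q M) (sym K≡MQ)))
  last-many : Q ≤ countBelow K (_<ᵇ Q)
  last-many = ≤-trans (≤-reflexive (sym (countBelow-all Q (_<ᵇ Q) λ x x<Q → Equivalence.to T-≡ (<⇒<ᵇ x<Q))))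
    (window≤countBelow K 0 Q (_<ᵇ Q) Q≤K)
  initial-few : ∀ x → countBelow K (_≤ᵇ x) ≤ suc x
  initial-few x = ≤-trans (countBelow≤window K 0 (suc x) (_≤ᵇ x) λ y le → z≤n , s≤s (≤ᵇ≡⇒≤ le)) (countBelow≤ (suc x) (_≤ᵇ x))
  few : ∀ x → x < K → 32 * d * (countBelow K (λ y → (y <ᵇ Q) ∧ R x y) * suc x) ≤ K * K
  few x _ = begin
    32 * d * (countBelow K (λ y → (y <ᵇ Q) ∧ R x y) * suc x)  ≤⟨ *-monoʳ-≤ (32 * d) (R-few K x) ⟩
    32 * d * (2 * Q * 2 ^ I)          ≡⟨ r₃ d Q (2 ^ I) ⟩
    64 * d * (Q * 2 ^ I)              ≤⟨ *-monoˡ-≤ (Q * 2 ^ I) M²I≥ ⟩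
    M * M * I * (Q * 2 ^ I)           ≡⟨ r₄ M I Q (2 ^ I) ⟩
    M * Q * (M * (I * 2 ^ I))         ≡⟨ sym (cong₂ _*_ K≡MQ K≡MQ) ⟩
    K * K                             ∎
    where
    open ≤-Reasoning
    r₃ : ∀ d q p → 32 * d * (2 * q * p) ≡ 64 * d * (q * p)
    r₃ = solve-∀
    r₄ : ∀ m i q p → m * m * i * (q * p) ≡ m * q * (m * (i * p))
    r₄ = solve-∀

-- Choice of the parameters

squares-reflect-≤ : ∀ {m n} → m * m ≤ n * n → m ≤ n
squares-reflect-≤ le = ≮⇒≥ λ lt → <⇒≱ (*-mono-< lt lt) le

geometric-bracket : ∀ b c .{{_ : NonZero c}} D → 1 < b → c ≤ D → ∃[ e ] (b ^ e * c ≤ D × D < b ^ suc e * c)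
geometric-bracket b c D 1<b c≤D = subst (λ D → ∃[ e ] (b ^ e * c ≤ D × D < b ^ suc e * c))
  (m+[n∸m]≡n c≤D) (from-c (D ∸ c))
  where
  instance
    b≢0 : NonZero b
    b≢0 = >-nonZero (<-trans z<s 1<b)
  grows : ∀ e → b ^ e * c < b ^ suc e * c
  grows e = *-monoˡ-< c (^-monoʳ-< b 1<b (n<1+n e))
  from-c : ∀ k → ∃[ e ] (b ^ e * c ≤ c + k × c + k < b ^ suc e * c)
  from-c zero    = 0 , ≤-reflexive (trans (+-identityʳ c) (sym (+-identityʳ c)))
                     , subst (_< b ^ 1 * c) (trans (+-identityʳ c) (sym (+-identityʳ c))) (grows 0)
  from-c (suc k) with from-c k
  ... | e , lo , hi rewrite +-suc c k with suc (c + k) <? b ^ suc e * c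
  ...   | yes lt = e , m≤n⇒m≤1+n lo , lt
  ...   | no ge  = suc e , ≮⇒≥ ge , ≤-<-trans hi (grows (suc e))

-- Applied with J = 9 + k, this yields the exponential room for the local lemma; 9 is the least J
-- with 4 + 48 (J + 1) ≤ 2 ^ J.
linear≤exponential : ∀ k → 4 + 48 * (10 + k) ≤ 2 ^ (9 + k)
linear≤exponential zero    = m≤m+n 484 28
linear≤exponential (suc k) = begin
  4 + 48 * (10 + suc k)                ≡⟨ r k ⟩
  4 + 48 * (10 + k) + 48               ≤⟨ +-mono-≤ (linear≤exponential k) (≤-trans (m≤m+n 48 436) (≤-trans (m≤m+n 484 (48 * k)) (≤-trans (≤-reflexive (r′ k)) (linear≤exponential k)))) ⟩
  2 ^ (9 + k) + 2 ^ (9 + k)            ≡⟨ cong (λ x → 2 ^ (9 + k) + x) (sym (+-identityʳ _)) ⟩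
  2 * 2 ^ (9 + k)                      ≡⟨⟩
  2 ^ suc (9 + k)                      ≡⟨ cong (2 ^_) (sym (+-suc 9 k)) ⟩
  2 ^ (9 + suc k)                      ∎
  where
  open ≤-Reasoning
  r : ∀ k → 4 + 48 * (10 + suc k) ≡ 4 + 48 * (10 + k) + 48
  r = solve-∀
  r′ : ∀ k → 484 + 48 * k ≡ 4 + 48 * (10 + k)
  r′ = solve-∀

1+n≤2^n : ∀ n → suc n ≤ 2 ^ n
1+n≤2^n zero    = s≤s z≤n
1+n≤2^n (suc n) = ≤-trans (s≤s (m≤n+m (suc n) n)) (≤-trans (≤-reflexive (r n)) (*-monoʳ-≤ 2 (1+n≤2^n n)))
  where
  r : ∀ n → suc (n + suc n) ≡ 2 * suc n
  r = solve-∀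

-- J is roughly (log₂ d) / 16, M is a power of 2 close to 8 √(d / (1 + J)), there
-- are 2 * m labels, and each occurs at least 2 ^ J times in every neighbourhood
-- up to a constant factor.
record Parameters (g d : ℕ) : Set where
  field
    J M     : ℕ
    M≢0     : NonZero M
  m : ℕ
  m = M * (suc J * 2 ^ J)
  field
    d<      : d < 2 ^ (16 * suc J)
    M²I≥    : 64 * d ≤ M * M * suc J
    M²I≤    : M * M * suc J ≤ 256 * d
    2^I≤M   : 2 ^ suc J ≤ M
    128M≤   : 128 * M ≤ 8 * m * 2 ^ J
    8mq≤    : 2 ^ g * suc (8 * m * 2 ^ J) ≤ d
    room    : 16 * (d * d) * m ≤ 2 ^ (2 ^ J)

-- The first bracket places d between consecutive powers of 2 ^ 16 and fixes J. The second fixes e,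
-- and M = 2 * 2 ^ e then has M² I = 4 ^ (e + 1) I between 64 d and 256 d.
module FromBrackets (g d J e : ℕ) (d≥ : 2 ^ (16 * (9 + g)) ≤ d)
  (J-low : (2 ^ 16) ^ J * 1 ≤ d) (J-high : d < (2 ^ 16) ^ suc J * 1)
  (e-low : 4 ^ e * suc J ≤ 64 * d) (e-high : 64 * d < 4 ^ suc e * suc J) where

  open ≤-Reasoning
  instance
    d≢0 : NonZero d
    d≢0 = >-nonZero (≤-trans (m^n>0 2 (16 * (9 + g))) d≥)
  1≤d : 1 ≤ d
  1≤d = >-nonZero⁻¹ d
  I = suc J
  p = 2 ^ J
  D = 2 ^ (16 * I)
  instance
    p≢0 : NonZero p
    p≢0 = m^n≢0 2 J
  d< : d < 2 ^ (16 * I)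
  d< = subst (d <_) (trans (*-identityʳ _) (^-*-assoc 2 16 I)) J-high
  p^16≤d : p ^ 16 ≤ d
  p^16≤d = subst (_≤ d) (trans (*-identityʳ _) (trans (^-*-assoc 2 16 J)
    (trans (cong (2 ^_) (*-comm 16 J)) (sym (^-*-assoc 2 J 16))))) J-low
  -- The lower bound on d is chosen for this: the 9 serves `exponent`, and the g serves `2^g≤p`.
  9+g≤J : 9 + g ≤ J
  9+g≤J = ≮⇒≥ λ J< → <⇒≱ d< (≤-trans (^-monoʳ-≤ 2 (*-monoʳ-≤ 16 J<)) d≥)
  2^g≤p : 2 ^ g ≤ p
  2^g≤p = ^-monoʳ-≤ 2 (≤-trans (m≤n+m g 9) 9+g≤J)
  4≤p : 4 ≤ p
  4≤p = ^-monoʳ-≤ 2 {2} {J} (≤-trans (m≤m+n 2 7) (≤-trans (m≤m+n 9 g) 9+g≤J))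
  I≤p : I ≤ p
  I≤p = 1+n≤2^n J
  M = 2 * 2 ^ e
  M≢0 : NonZero M
  M≢0 = m*n≢0 2 (2 ^ e) {{it}} {{m^n≢0 2 e}}
  instance
    M≢0′ : NonZero M
    M≢0′ = M≢0
  m = M * (I * p)
  4^e : 4 ^ e ≡ 2 ^ e * 2 ^ e
  4^e = trans (^-*-assoc 2 2 e) (trans (cong (2 ^_) (cong (λ x → e + x) (+-identityʳ e))) (^-distribˡ-+-* 2 e e))
  r-4^ : ∀ x i → 4 * (x * x) * i ≡ 2 * x * (2 * x) * i
  r-4^ = solve-∀
  M²I≤ : M * M * I ≤ 256 * d
  M²I≤ = begin
    M * M * I             ≡⟨ trans (sym (r-4^ (2 ^ e) I)) (*-assoc 4 (2 ^ e * 2 ^ e) I) ⟩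
    4 * (2 ^ e * 2 ^ e * I) ≡⟨ cong (λ x → 4 * (x * I)) (sym 4^e) ⟩
    4 * (4 ^ e * I)       ≤⟨ *-monoʳ-≤ 4 e-low ⟩
    4 * (64 * d)          ≡⟨ sym (*-assoc 4 64 d) ⟩
    256 * d               ∎
  M²I≥′ : 64 * d ≤ M * M * I
  M²I≥′ = <⇒≤ (subst (64 * d <_) (r-4^ (2 ^ e) I) (subst (λ x → 64 * d < 4 * x * I) 4^e e-high))
  r-128 : ∀ M → 128 * M ≡ 8 * (M * (1 * 4)) * 4
  r-128 = solve-∀
  2^I²≤ : 2 * p * (2 * p) ≤ M * M
  2^I²≤ = *-cancelʳ-≤ _ _ p (begin
    2 * p * (2 * p) * p   ≡⟨ r₁ p ⟩
    4 * p ^ 3             ≤⟨ *-mono-≤ (m≤m+n 4 60) (^-monoʳ-≤ p {3} {16} (m≤m+n 3 13)) ⟩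
    64 * p ^ 16           ≤⟨ *-monoʳ-≤ 64 p^16≤d ⟩
    64 * d                ≤⟨ M²I≥′ ⟩
    M * M * I             ≤⟨ *-monoʳ-≤ (M * M) I≤p ⟩
    M * M * p             ∎)
    where
    r₁ : ∀ p → 2 * p * (2 * p) * p ≡ 4 * (p * (p * (p * 1)))
    r₁ = solve-∀
  G = 2 ^ g
  -- Squaring brings in M² I, which is under control: the left side is 81 G² (M² I) I p ^ 4 and so
  -- at most 20736 p ^ 7 d. Here 20736 = 81 * 256 ≤ 4 ^ 8 ≤ p ^ 8, and p ^ 16 ≤ d.
  few² : G * (9 * (m * p)) * (G * (9 * (m * p))) ≤ d * d
  few² = begin
    G * (9 * (M * (I * p) * p)) * (G * (9 * (M * (I * p) * p)))
      ≡⟨ r₁ G M I p ⟩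
    81 * (G * G) * (M * M * I) * (I * (p * p * (p * p)))
      ≤⟨ *-mono-≤ (*-mono-≤ (*-monoʳ-≤ 81 (*-mono-≤ 2^g≤p 2^g≤p)) M²I≤) (*-monoˡ-≤ _ I≤p) ⟩
    81 * (p * p) * (256 * d) * (p * (p * p * (p * p)))
      ≡⟨ r₂ p d ⟩
    20736 * (p * p) * (p * (p * p * (p * p))) * d
      ≤⟨ *-monoˡ-≤ d (*-monoˡ-≤ (p * (p * p * (p * p))) (*-monoˡ-≤ (p * p) (≤-trans (m≤m+n 20736 44800) (^-monoˡ-≤ 8 4≤p)))) ⟩
    p ^ 8 * (p * p) * (p * (p * p * (p * p))) * d
      ≤⟨ *-monoˡ-≤ d (≤-trans (m≤m*n (p ^ 8 * (p * p) * (p * (p * p * (p * p)))) p) (≤-reflexive (trans (r₃ (p ^ 8) p) (sym (^-distribˡ-+-* p 8 8))))) ⟩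
    p ^ 16 * d
      ≤⟨ *-monoˡ-≤ d p^16≤d ⟩
    d * d ∎
    where
    r₁ : ∀ G M I p → G * (9 * (M * (I * p) * p)) * (G * (9 * (M * (I * p) * p))) ≡ 81 * (G * G) * (M * M * I) * (I * (p * p * (p * p)))
    r₁ = solve-∀
    r₂ : ∀ p d → 81 * (p * p) * (256 * d) * (p * (p * p * (p * p))) ≡ 20736 * (p * p) * (p * (p * p * (p * p))) * d
    r₂ = solve-∀
    r₃ : ∀ a p → a * (p * p) * (p * (p * p * (p * p))) * p ≡ a * (p * (p * (p * (p * (p * (p * (p * (p * (1)))))))))
    r₃ = solve-∀
  1≤mp : 1 ≤ m * p
  1≤mp = >-nonZero⁻¹ (m * p) {{m*n≢0 m p {{m*n≢0 M (I * p) {{it}} {{m*n≢0 I p}}}}}}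
  few : G * suc (8 * m * p) ≤ d
  few = ≤-trans (*-monoʳ-≤ G (≤-trans (+-monoˡ-≤ (8 * m * p) 1≤mp) (≤-reflexive (r (m * p) m p refl)))) (squares-reflect-≤ few²)
    where
    r : ∀ x m p → x ≡ m * p → x + 8 * m * p ≡ 9 * (m * p)
    r _ m p refl = r′ m p
      where
      r′ : ∀ m p → m * p + 8 * m * p ≡ 9 * (m * p)
      r′ = solve-∀
  m≤d : m ≤ d
  m≤d = begin
    m                   ≤⟨ m≤n*m m 8 ⟩
    8 * m               ≤⟨ m≤m*n (8 * m) p ⟩
    8 * m * p           ≤⟨ n≤1+n _ ⟩
    suc (8 * m * p)     ≤⟨ m≤n*m _ G {{m^n≢0 2 g}} ⟩
    G * suc (8 * m * p) ≤⟨ few ⟩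
    d                   ∎
  powers : 16 * (D * D) * D ≡ 2 ^ (4 + 48 * I)
  powers = begin-equality
    16 * (D * D) * D                     ≡⟨ r₁ D ⟩
    2 ^ 4 * D ^ 3                        ≡⟨ cong (2 ^ 4 *_) (trans (^-*-assoc 2 (16 * I) 3) (cong (2 ^_) (r₂ I))) ⟩
    2 ^ 4 * 2 ^ (48 * I)                 ≡⟨ sym (^-distribˡ-+-* 2 4 (48 * I)) ⟩
    2 ^ (4 + 48 * I)                     ∎
    where
    r₁ : ∀ D → 16 * (D * D) * D ≡ 16 * (D * (D * (D * 1)))
    r₁ = solve-∀
    r₂ : ∀ I → 16 * I * 3 ≡ 48 * I
    r₂ = solve-∀
  exponent : 4 + 48 * I ≤ p
  exponent = subst (λ J → 4 + 48 * suc J ≤ 2 ^ J) (m+[n∸m]≡n {9} {J} (≤-trans (m≤m+n 9 g) 9+g≤J)) (linear≤exponential (J ∸ 9))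


  parameters-at : Parameters g d
  parameters-at = record
    { J = J ; M = M ; M≢0 = M≢0 ; d< = d<
    ; M²I≥ = M²I≥′
    ; M²I≤ = M²I≤
    ; 2^I≤M = squares-reflect-≤ 2^I²≤
    ; 128M≤ = begin
        128 * M                        ≡⟨ r-128 M ⟩
        8 * (M * (1 * 4)) * 4          ≤⟨ *-mono-≤ (*-monoʳ-≤ 8 (*-monoʳ-≤ M (*-mono-≤ (s≤s (z≤n {J})) 4≤p))) 4≤p ⟩
        8 * (M * (I * p)) * p          ∎
    ; 8mq≤ = few
    ; room = begin
        16 * (d * d) * m               ≤⟨ *-monoʳ-≤ (16 * (d * d)) m≤d ⟩
        16 * (d * d) * d               ≤⟨ *-mono-≤ (*-monoʳ-≤ 16 (*-mono-≤ (<⇒≤ d<) (<⇒≤ d<))) (<⇒≤ d<) ⟩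
        16 * (D * D) * D               ≡⟨ powers ⟩
        2 ^ (4 + 48 * I)               ≤⟨ ^-monoʳ-≤ 2 exponent ⟩
        2 ^ p                          ∎
    }

parameters : ∀ g d → 2 ^ (16 * (9 + g)) ≤ d → Parameters g d
parameters g d d≥ = parameters-at
  where
  1≤d : 1 ≤ d
  1≤d = ≤-trans (m^n>0 2 (16 * (9 + g))) d≥
  bracket-J = geometric-bracket (2 ^ 16) 1 d (s≤s (s≤s z≤n)) 1≤d
  J = proj₁ bracket-J
  J<d : suc J ≤ 64 * d
  J<d = begin
    suc J            ≤⟨ 1+n≤2^n J ⟩
    2 ^ J            ≤⟨ ^-monoˡ-≤ J (m≤m+n 2 65534) ⟩
    (2 ^ 16) ^ J     ≡⟨ sym (*-identityʳ _) ⟩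
    (2 ^ 16) ^ J * 1 ≤⟨ proj₁ (proj₂ bracket-J) ⟩
    d                ≤⟨ m≤n*m d 64 ⟩
    64 * d           ∎
    where open ≤-Reasoning
  bracket-e = geometric-bracket 4 (suc J) (64 * d) (s≤s (s≤s z≤n)) J<d
  open FromBrackets g d J (proj₁ bracket-e) d≥ (proj₁ (proj₂ bracket-J)) (proj₂ (proj₂ bracket-J))
    (proj₁ (proj₂ bracket-e)) (proj₂ (proj₂ bracket-e))

-- Real numbers

ι : ℕ → ℚ
ι n = + n / 1

toℚᵘ-/1 : ∀ z → ℚ.toℚᵘ (z / 1) ℚᵘ.≃ mkℚᵘ z 0
toℚᵘ-/1 z = ℚₚ.toℚᵘ-fromℚᵘ (mkℚᵘ z 0)

ι-mono : ∀ {m n} → m ℕ.≤ n → ι m ℚ.≤ ι n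
ι-mono {m} {n} m≤n = ℚₚ.toℚᵘ-cancel-≤ (begin
  ℚ.toℚᵘ (ι m)     ≃⟨ toℚᵘ-/1 (+ m) ⟩
  mkℚᵘ (+ m) 0     ≤⟨ *≤* (ℤₚ.*-monoʳ-≤-nonNeg (+ 1) (ℤ.+≤+ m≤n)) ⟩
  mkℚᵘ (+ n) 0     ≃⟨ ℚᵘₚ.≃-sym (toℚᵘ-/1 (+ n)) ⟩
  ℚ.toℚᵘ (ι n)     ∎)
  where open ℚᵘₚ.≤-Reasoning

ι-reflects-≤ : ∀ {m n} → ι m ℚ.≤ ι n → m ℕ.≤ n
ι-reflects-≤ {m} {n} le = ℤₚ.drop‿+≤+ (subst₂ ℤ._≤_ (ℤₚ.*-identityʳ (+ m)) (ℤₚ.*-identityʳ (+ n))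
  (ℚᵘₚ.drop-*≤* (begin
    mkℚᵘ (+ m) 0     ≃⟨ ℚᵘₚ.≃-sym (toℚᵘ-/1 (+ m)) ⟩
    ℚ.toℚᵘ (ι m)     ≤⟨ ℚₚ.toℚᵘ-mono-≤ le ⟩
    ℚ.toℚᵘ (ι n)     ≃⟨ toℚᵘ-/1 (+ n) ⟩
    mkℚᵘ (+ n) 0     ∎)))
  where open ℚᵘₚ.≤-Reasoning

ι-+ : ∀ m n → ι (m ℕ.+ n) ≡ ι m ℚ.+ ι n
ι-+ m n = ℚₚ.toℚᵘ-injective (begin-equality
  ℚ.toℚᵘ (ι (m ℕ.+ n))                 ≃⟨ toℚᵘ-/1 (+ (m ℕ.+ n)) ⟩
  mkℚᵘ (+ (m ℕ.+ n)) 0                 ≃⟨ ℚᵘₚ.≃-reflexive (cong (λ z → mkℚᵘ z 0) (sym (cong₂ ℤ._+_ (ℤₚ.*-identityʳ (+ m)) (ℤₚ.*-identityʳ (+ n))))) ⟩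
  mkℚᵘ (+ m) 0 ℚᵘ.+ mkℚᵘ (+ n) 0       ≃⟨ ℚᵘₚ.+-cong (ℚᵘₚ.≃-sym (toℚᵘ-/1 (+ m))) (ℚᵘₚ.≃-sym (toℚᵘ-/1 (+ n))) ⟩
  ℚ.toℚᵘ (ι m) ℚᵘ.+ ℚ.toℚᵘ (ι n)       ≃⟨ ℚᵘₚ.≃-sym (ℚₚ.toℚᵘ-homo-+ (ι m) (ι n)) ⟩
  ℚ.toℚᵘ (ι m ℚ.+ ι n)                 ∎)
  where open ℚᵘₚ.≤-Reasoning

ι-* : ∀ m n → ι (m ℕ.* n) ≡ ι m ℚ.* ι n
ι-* m n = ℚₚ.toℚᵘ-injective (begin-equality
  ℚ.toℚᵘ (ι (m ℕ.* n))                 ≃⟨ toℚᵘ-/1 (+ (m ℕ.* n)) ⟩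
  mkℚᵘ (+ (m ℕ.* n)) 0                 ≃⟨ ℚᵘₚ.≃-reflexive (cong (λ z → mkℚᵘ z 0) (ℤₚ.pos-* m n)) ⟩
  mkℚᵘ (+ m) 0 ℚᵘ.* mkℚᵘ (+ n) 0       ≃⟨ ℚᵘₚ.*-cong (ℚᵘₚ.≃-sym (toℚᵘ-/1 (+ m))) (ℚᵘₚ.≃-sym (toℚᵘ-/1 (+ n))) ⟩
  ℚ.toℚᵘ (ι m) ℚᵘ.* ℚ.toℚᵘ (ι n)       ≃⟨ ℚᵘₚ.≃-sym (ℚₚ.toℚᵘ-homo-* (ι m) (ι n)) ⟩
  ℚ.toℚᵘ (ι m ℚ.* ι n)                 ∎)
  where open ℚᵘₚ.≤-Reasoning

0≤ι : ∀ n → 0ℚ ℚ.≤ ι n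
0≤ι n = ι-mono {0} {n} z≤n

ι-nonNeg : ∀ n → ℚ.NonNegative (ι n)
ι-nonNeg n = ℚ.nonNegative (0≤ι n)

*ℚ-mono-≤ : ∀ {a b c d} → 0ℚ ℚ.≤ a → 0ℚ ℚ.≤ d → a ℚ.≤ b → c ℚ.≤ d → a ℚ.* c ℚ.≤ b ℚ.* d
*ℚ-mono-≤ {a} {b} {c} {d} 0≤a 0≤d a≤b c≤d = ℚₚ.≤-trans
  (ℚₚ.*-monoˡ-≤-nonNeg a {{ℚ.nonNegative 0≤a}} c≤d)
  (ℚₚ.*-monoʳ-≤-nonNeg d {{ℚ.nonNegative 0≤d}} a≤b)

*ι! : ∀ n → ι (n !) ℚ.* invFactorial n ≡ 1ℚ
*ι! n = ℚₚ.toℚᵘ-injective (begin-equality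
  ℚ.toℚᵘ (ι (n !) ℚ.* invFactorial n)               ≃⟨ ℚₚ.toℚᵘ-homo-* (ι (n !)) (invFactorial n) ⟩
  ℚ.toℚᵘ (ι (n !)) ℚᵘ.* ℚ.toℚᵘ (invFactorial n)     ≃⟨ ℚᵘₚ.*-cong (toℚᵘ-/1 (+ (n !))) inv ⟩
  mkℚᵘ (+ (n !)) 0 ℚᵘ.* mkℚᵘ (+ 1) (ℕ.pred (n !))   ≃⟨ *≡* prod ⟩
  ℚᵘ.1ℚᵘ                                            ∎)
  where
  open ℚᵘₚ.≤-Reasoning
  suc-pred! : suc (ℕ.pred (n !)) ≡ n !
  suc-pred! = ℕₚ.suc-pred (n !) {{n ℕₚ.!≢0}}
  inv-gen : ∀ k {{_ : ℕ.NonZero k}} → ℚ.toℚᵘ (+ 1 / k) ℚᵘ.≃ mkℚᵘ (+ 1) (ℕ.pred k)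
  inv-gen (suc k) = ℚₚ.toℚᵘ-fromℚᵘ (mkℚᵘ (+ 1) k)
  inv : ℚ.toℚᵘ (invFactorial n) ℚᵘ.≃ mkℚᵘ (+ 1) (ℕ.pred (n !))
  inv = inv-gen (n !) {{n ℕₚ.!≢0}}
  prod : (+ (n !) ℤ.* + 1) ℤ.* + 1 ≡ + 1 ℤ.* (+ 1 ℤ.* + suc (ℕ.pred (n !)))
  prod = trans (ℤₚ.*-identityʳ _) (trans (ℤₚ.*-identityʳ _) (sym (trans (ℤₚ.*-identityˡ _)
    (trans (ℤₚ.*-identityˡ _) (cong +_ suc-pred!)))))

0≤invFactorial : ∀ n → 0ℚ ℚ.≤ invFactorial n
0≤invFactorial n = ℚₚ.nonNegative⁻¹ (invFactorial n) {{ℚₚ.normalize-nonNeg 1 (n !) {{n ℕₚ.!≢0}}}}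

module _ (x : ℝ) (m : ℕ) where

  power term partialSum : ℕ → ℚ
  power j = seq (x ^ᴿ j) m
  term j = power j ℚ.* invFactorial j
  partialSum j = seq (expSum x j) m

  module _ (i : ℕ) (large : ι (2 ℕ.* i) ℚ.≤ seq x m) where

    -- For j < i the factor x ≥ 2 i dominates 2 (j + 1), the quotient of consecutive left sides.
    power≥ : ∀ j → j ℕ.≤ i → ι (2 ℕ.^ j ℕ.* j !) ℚ.≤ power j
    power≥ zero    _   = ℚₚ.≤-refl
    power≥ (suc j) j<i = begin
      ι (2 ℕ.* 2 ℕ.^ j ℕ.* (suc j ℕ.* j !))      ≡⟨ cong ι (r (2 ℕ.^ j) (suc j) (j !)) ⟩
      ι (2 ℕ.* suc j ℕ.* (2 ℕ.^ j ℕ.* j !))      ≡⟨ ι-* (2 ℕ.* suc j) (2 ℕ.^ j ℕ.* j !) ⟩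
      ι (2 ℕ.* suc j) ℚ.* ι (2 ℕ.^ j ℕ.* j !)    ≤⟨ *ℚ-mono-≤ (0≤ι (2 ℕ.* suc j)) (ℚₚ.≤-trans (0≤ι (2 ℕ.^ j ℕ.* j !)) IH)
                                                      (ℚₚ.≤-trans (ι-mono (ℕₚ.*-monoʳ-≤ 2 j<i)) large) IH ⟩
      seq x m ℚ.* power j                         ∎
      where
      open ℚₚ.≤-Reasoning
      IH = power≥ j (ℕₚ.<⇒≤ j<i)
      r : ∀ a b c → 2 ℕ.* a ℕ.* (b ℕ.* c) ≡ 2 ℕ.* b ℕ.* (a ℕ.* c)
      r = solve-∀

    term≥ : ι (2 ℕ.^ i) ℚ.≤ term i
    term≥ = begin
      ι (2 ℕ.^ i)                                         ≡⟨ sym (ℚₚ.*-identityʳ _) ⟩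
      ι (2 ℕ.^ i) ℚ.* 1ℚ                                  ≡⟨ cong (ι (2 ℕ.^ i) ℚ.*_) (sym (*ι! i)) ⟩
      ι (2 ℕ.^ i) ℚ.* (ι (i !) ℚ.* invFactorial i)        ≡⟨ sym (ℚₚ.*-assoc (ι (2 ℕ.^ i)) (ι (i !)) (invFactorial i)) ⟩
      ι (2 ℕ.^ i) ℚ.* ι (i !) ℚ.* invFactorial i          ≡⟨ cong (ℚ._* invFactorial i) (sym (ι-* (2 ℕ.^ i) (i !))) ⟩
      ι (2 ℕ.^ i ℕ.* i !) ℚ.* invFactorial i              ≤⟨ ℚₚ.*-monoʳ-≤-nonNeg (invFactorial i) {{ℚ.nonNegative (0≤invFactorial i)}} (power≥ i ℕₚ.≤-refl) ⟩
      term i                                              ∎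
      where open ℚₚ.≤-Reasoning

    0≤x : 0ℚ ℚ.≤ seq x m
    0≤x = ℚₚ.≤-trans (0≤ι (2 ℕ.* i)) large

    0≤power : ∀ j → 0ℚ ℚ.≤ power j
    0≤power zero    = 0≤ι 1
    0≤power (suc j) = ℚₚ.≤-trans (ℚₚ.≤-reflexive (sym (ℚₚ.*-zeroˡ 0ℚ)))
      (*ℚ-mono-≤ ℚₚ.≤-refl (0≤power j) 0≤x (0≤power j))

    0≤term : ∀ j → 0ℚ ℚ.≤ term j
    0≤term j = ℚₚ.≤-trans (ℚₚ.≤-reflexive (sym (ℚₚ.*-zeroˡ 0ℚ)))
      (*ℚ-mono-≤ ℚₚ.≤-refl (0≤invFactorial j) (0≤power j) (0≤invFactorial j))

    0≤partialSum : ∀ j → 0ℚ ℚ.≤ partialSum j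
    0≤partialSum zero    = ℚₚ.≤-refl
    0≤partialSum (suc j) = ℚₚ.+-mono-≤ (0≤partialSum j) (0≤term j)

    partialSum≥ : ∀ j → i ℕ.< j → ι (2 ℕ.^ i) ℚ.≤ partialSum j
    partialSum≥ (suc j) (s≤s i≤j) with ℕₚ.m≤n⇒m<n∨m≡n i≤j
    ... | inj₂ refl = ℚₚ.≤-trans term≥ (ℚₚ.≤-trans (ℚₚ.≤-reflexive (sym (ℚₚ.+-identityˡ (term i))))
      (ℚₚ.+-monoˡ-≤ (term i) (0≤partialSum i)))
    ... | inj₁ i<j = ℚₚ.≤-trans (partialSum≥ j i<j) (ℚₚ.≤-trans (ℚₚ.≤-reflexive (sym (ℚₚ.+-identityʳ (partialSum j))))
      (ℚₚ.+-monoʳ-≤ (partialSum j) (0≤term j)))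

Eventually : (ℕ → Set) → Set
Eventually P = ∃[ k ] ∀ n → k ℕ.≤ n → P n

0<1 : 0ℚ ℚ.< 1ℚ
0<1 = ℚₚ.positive⁻¹ 1ℚ

-- For x ≥ 2i the term x^i / i! of the exponential series is at least 2^i.
log≤ : ∀ d i ℓ → 1 ℕ.≤ d → 2 ℕ.* suc d ℕ.≤ 2 ℕ.^ i → IsLog (fromℕ d) ℓ →
       Eventually λ n → seq ℓ n ℚ.≤ ι (2 ℕ.* i)
log≤ d i ℓ 1≤d 2^i≥ exp-ℓ with exp-ℓ 1ℚ 0<1
... | k , close with proj₁ (close (k ℕ.⊔ suc i) (ℕₚ.m≤m⊔n k (suc i))) 1ℚ 0<1
...   | k′ , bounded = k′ , λ n n≥ → ℚₚ.≮⇒≥ λ big →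
          ℕₚ.<⇒≱ (ℕₚ.≤-trans small 2^i≥)
            (ι-reflects-≤ {2 ℕ.^ i} {d ℕ.+ 1 ℕ.+ 1} (ℚₚ.≤-trans (partialSum≥ ℓ n i (ℚₚ.<⇒≤ big) (k ℕ.⊔ suc i) (ℕₚ.m≤n⊔m k (suc i)))
              (ℚₚ.≤-trans (bounded n n≥) (ℚₚ.≤-reflexive
                (trans (cong (ℚ._+ 1ℚ) (sym (ι-+ d 1))) (sym (ι-+ (d ℕ.+ 1) 1)))))))
  where
  small : suc (d ℕ.+ 1 ℕ.+ 1) ℕ.≤ 2 ℕ.* suc d
  small = ℕₚ.≤-trans (ℕₚ.+-monoʳ-≤ 1 (ℕₚ.+-monoˡ-≤ 1 (ℕₚ.+-monoʳ-≤ d 1≤d))) (ℕₚ.≤-reflexive (r d))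
    where
    r : ∀ d → suc (d ℕ.+ d ℕ.+ 1) ≡ 2 ℕ.* suc d
    r = solve-∀

archimedean : ∀ ε → 0ℚ ℚ.< ε → ∃[ q ] 1ℚ ℚ.≤ ι q ℚ.* ε
archimedean ε@(mkℚ (+ suc a) b _) _ = suc b , ℚₚ.toℚᵘ-cancel-≤ (begin
  mkℚᵘ (+ 1) 0                              ≤⟨ *≤* (ℤ.+≤+ le) ⟩
  mkℚᵘ (+ suc b) 0 ℚᵘ.* mkℚᵘ (+ suc a) b    ≃⟨ ℚᵘₚ.*-congʳ {mkℚᵘ (+ suc a) b} (ℚᵘₚ.≃-sym (toℚᵘ-/1 (+ suc b))) ⟩
  ℚ.toℚᵘ (ι (suc b)) ℚᵘ.* ℚ.toℚᵘ ε          ≃⟨ ℚᵘₚ.≃-sym (ℚₚ.toℚᵘ-homo-* (ι (suc b)) ε) ⟩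
  ℚ.toℚᵘ (ι (suc b) ℚ.* ε)                  ∎)
  where
  open ℚᵘₚ.≤-Reasoning
  le : 1 ℕ.* (1 ℕ.* suc b) ≤ suc b ℕ.* suc a ℕ.* 1
  le = ℕₚ.≤-trans (ℕₚ.≤-reflexive (r b)) (ℕₚ.≤-trans (ℕₚ.m≤m*n (suc b) (suc a)) (ℕₚ.≤-reflexive (sym (ℕₚ.*-identityʳ _))))
    where
    r : ∀ b → 1 ℕ.* (1 ℕ.* suc b) ≡ suc b
    r = solve-∀
archimedean (mkℚ (+ zero) _ _) (ℚ.*<* (ℤ.+<+ ()))
archimedean (mkℚ (-[1+ _ ]) _ _) (ℚ.*<* ())

square-reflects-≤ : ∀ {x c} → 0ℚ ℚ.≤ c → x ℚ.* x ℚ.≤ c ℚ.* c → x ℚ.≤ c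
square-reflects-≤ {x} {c} 0≤c le = ℚₚ.≮⇒≥ λ c<x → ℚₚ.<-irrefl refl (ℚₚ.<-≤-trans (ℚₚ.≤-<-trans
  (ℚₚ.*-monoˡ-≤-nonNeg c {{ℚ.nonNegative 0≤c}} (ℚₚ.<⇒≤ c<x))
  (ℚₚ.*-monoˡ-<-pos x {{ℚ.positive (ℚₚ.≤-<-trans 0≤c c<x)}} c<x)) le)

-- The real hypotheses are read off at a single index with slack 1: a, s and l are the terms there
-- of the sequences for α, √(d log d) and log d, so that the estimates concern rationals and
-- naturals only.
module Index (g d δ : ℕ) (P : Parameters g d) (1≤d : 1 ≤ d) (a s l : ℚ) (0≤a : 0ℚ ℚ.≤ a)
  (aδ : a ℚ.* ι d ℚ.≤ ι δ ℚ.+ 1ℚ) (s² : s ℚ.* s ℚ.≤ ι d ℚ.* l ℚ.+ 1ℚ) where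

  open Parameters P
  I i₀ : ℕ
  I = suc J
  -- From d < 2 ^ (16 I) follows 2 (d + 1) ≤ 2 ^ i₀, as `log≤` requires.
  i₀ = 1 ℕ.+ 16 ℕ.* I

  module _ (l≤ : l ℚ.≤ ι (2 ℕ.* i₀)) where

    s²≤ : s ℚ.* s ℚ.≤ ι (35 ℕ.* (d ℕ.* I))
    s²≤ = begin
      s ℚ.* s                                   ≤⟨ s² ⟩
      ι d ℚ.* l ℚ.+ 1ℚ                          ≤⟨ ℚₚ.+-monoˡ-≤ 1ℚ (ℚₚ.*-monoˡ-≤-nonNeg (ι d) {{ι-nonNeg d}} l≤) ⟩
      ι d ℚ.* ι (2 ℕ.* i₀) ℚ.+ ι 1  ≡⟨ sym (trans (ι-+ (d ℕ.* (2 ℕ.* i₀)) 1) (cong (ℚ._+ ι 1) (ι-* d (2 ℕ.* i₀)))) ⟩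
      ι (d ℕ.* (2 ℕ.* i₀) ℕ.+ 1)    ≤⟨ ι-mono nat ⟩
      ι (35 ℕ.* (d ℕ.* I))                      ∎
      where
      open ℚₚ.≤-Reasoning
      nat : d ℕ.* (2 ℕ.* i₀) ℕ.+ 1 ≤ 35 ℕ.* (d ℕ.* I)
      nat = ℕₚ.≤-trans (ℕₚ.≤-reflexive (r₁ d I)) (ℕₚ.≤-trans
        (ℕₚ.+-monoʳ-≤ (32 ℕ.* (d ℕ.* I)) (ℕₚ.+-mono-≤ (ℕₚ.*-monoʳ-≤ 2 (ℕₚ.m≤m*n d I)) (ℕₚ.*-mono-≤ 1≤d (s≤s z≤n))))
        (ℕₚ.≤-reflexive (r₂ (d ℕ.* I))))
        where
        r₁ : ∀ d i → d ℕ.* (2 ℕ.* suc (16 ℕ.* i)) ℕ.+ 1 ≡ 32 ℕ.* (d ℕ.* i) ℕ.+ (2 ℕ.* d ℕ.+ 1)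
        r₁ = solve-∀
        r₂ : ∀ x → 32 ℕ.* x ℕ.+ (2 ℕ.* x ℕ.+ x) ≡ 35 ℕ.* x
        r₂ = solve-∀

    -- In squares, M² s² ≤ 35 d (M² I) ≤ 35 * 256 d² = 8960 d², and 8960 ≤ 96² = 9216.
    Ms≤ : ι M ℚ.* s ℚ.≤ ι (96 ℕ.* d)
    Ms≤ = square-reflects-≤ (0≤ι (96 ℕ.* d)) (begin
      ι M ℚ.* s ℚ.* (ι M ℚ.* s)                 ≡⟨ r (ι M) s ⟩
      ι M ℚ.* ι M ℚ.* (s ℚ.* s)                 ≡⟨ cong (ℚ._* (s ℚ.* s)) (sym (ι-* M M)) ⟩
      ι (M ℕ.* M) ℚ.* (s ℚ.* s)                 ≤⟨ ℚₚ.*-monoˡ-≤-nonNeg (ι (M ℕ.* M)) {{ι-nonNeg (M ℕ.* M)}} s²≤ ⟩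
      ι (M ℕ.* M) ℚ.* ι (35 ℕ.* (d ℕ.* I))      ≡⟨ sym (ι-* (M ℕ.* M) (35 ℕ.* (d ℕ.* I))) ⟩
      ι (M ℕ.* M ℕ.* (35 ℕ.* (d ℕ.* I)))        ≤⟨ ι-mono nat ⟩
      ι (96 ℕ.* d ℕ.* (96 ℕ.* d))               ≡⟨ ι-* (96 ℕ.* d) (96 ℕ.* d) ⟩
      ι (96 ℕ.* d) ℚ.* ι (96 ℕ.* d)             ∎)
      where
      open ℚₚ.≤-Reasoning
      r : ∀ m s → m ℚ.* s ℚ.* (m ℚ.* s) ≡ m ℚ.* m ℚ.* (s ℚ.* s)
      r = solve 2 (λ m s → m :* s :* (m :* s) := m :* m :* (s :* s)) refl
        where open ℚSolver.+-*-Solver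
      nat : M ℕ.* M ℕ.* (35 ℕ.* (d ℕ.* I)) ≤ 96 ℕ.* d ℕ.* (96 ℕ.* d)
      nat = ℕₚ.≤-trans (ℕₚ.≤-reflexive (r₁ (M ℕ.* M) d I)) (ℕₚ.≤-trans
        (ℕₚ.*-monoʳ-≤ (35 ℕ.* d) M²I≤)
        (ℕₚ.≤-trans (ℕₚ.≤-reflexive (r₂ d)) (ℕₚ.≤-trans (ℕₚ.*-monoˡ-≤ (d ℕ.* d) (ℕₚ.m≤m+n 8960 256)) (ℕₚ.≤-reflexive (r₃ d)))))
        where
        r₁ : ∀ m d i → m ℕ.* (35 ℕ.* (d ℕ.* i)) ≡ 35 ℕ.* d ℕ.* (m ℕ.* i)
        r₁ = solve-∀
        r₂ : ∀ d → 35 ℕ.* d ℕ.* (256 ℕ.* d) ≡ 8960 ℕ.* (d ℕ.* d)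
        r₂ = solve-∀
        r₃ : ∀ d → 9216 ℕ.* (d ℕ.* d) ≡ 96 ℕ.* d ℕ.* (96 ℕ.* d)
        r₃ = solve-∀

    1000Mt≤ : ∀ t → ι t ℚ.≤ a ℚ.* (+ 1 / 1000) ℚ.* s ℚ.+ 1ℚ →
              1000 ℕ.* M ℕ.* t ≤ 96 ℕ.* (δ ℕ.+ 1) ℕ.+ 1000 ℕ.* M
    1000Mt≤ t t≤ = ι-reflects-≤ (begin
      ι (1000 ℕ.* M ℕ.* t)                                  ≡⟨ ι-* (1000 ℕ.* M) t ⟩
      ι (1000 ℕ.* M) ℚ.* ι t                                ≤⟨ ℚₚ.*-monoˡ-≤-nonNeg (ι (1000 ℕ.* M)) {{ι-nonNeg (1000 ℕ.* M)}} t≤ ⟩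
      ι (1000 ℕ.* M) ℚ.* (a ℚ.* c ℚ.* s ℚ.+ 1ℚ)             ≡⟨ cong (ℚ._* (a ℚ.* c ℚ.* s ℚ.+ 1ℚ)) (ι-* 1000 M) ⟩
      ι 1000 ℚ.* ι M ℚ.* (a ℚ.* c ℚ.* s ℚ.+ 1ℚ)             ≡⟨ r₁ (ι 1000) (ι M) a c s ⟩
      ι 1000 ℚ.* c ℚ.* (a ℚ.* (ι M ℚ.* s)) ℚ.+ ι 1000 ℚ.* ι M
        ≡⟨ cong₂ ℚ._+_ (ℚₚ.*-identityˡ (a ℚ.* (ι M ℚ.* s))) (sym (ι-* 1000 M)) ⟩
      a ℚ.* (ι M ℚ.* s) ℚ.+ ι (1000 ℕ.* M)
        ≤⟨ ℚₚ.+-monoˡ-≤ (ι (1000 ℕ.* M)) (ℚₚ.*-monoˡ-≤-nonNeg a {{ℚ.nonNegative 0≤a}} Ms≤) ⟩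
      a ℚ.* ι (96 ℕ.* d) ℚ.+ ι (1000 ℕ.* M)
        ≡⟨ cong (ℚ._+ ι (1000 ℕ.* M)) (trans (cong (a ℚ.*_) (ι-* 96 d)) (r₂ a (ι 96) (ι d))) ⟩
      ι 96 ℚ.* (a ℚ.* ι d) ℚ.+ ι (1000 ℕ.* M)
        ≤⟨ ℚₚ.+-monoˡ-≤ (ι (1000 ℕ.* M)) (ℚₚ.*-monoˡ-≤-nonNeg (ι 96) {{ι-nonNeg 96}} aδ) ⟩
      ι 96 ℚ.* (ι δ ℚ.+ ι 1) ℚ.+ ι (1000 ℕ.* M)
        ≡⟨ cong (ℚ._+ ι (1000 ℕ.* M)) (trans (cong (ι 96 ℚ.*_) (sym (ι-+ δ 1))) (sym (ι-* 96 (δ ℕ.+ 1)))) ⟩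
      ι (96 ℕ.* (δ ℕ.+ 1)) ℚ.+ ι (1000 ℕ.* M)               ≡⟨ sym (ι-+ (96 ℕ.* (δ ℕ.+ 1)) (1000 ℕ.* M)) ⟩
      ι (96 ℕ.* (δ ℕ.+ 1) ℕ.+ 1000 ℕ.* M)                   ∎)
      where
      open ℚₚ.≤-Reasoning
      c = + 1 / 1000
      r₁ : ∀ k m a c s → k ℚ.* m ℚ.* (a ℚ.* c ℚ.* s ℚ.+ 1ℚ) ≡ k ℚ.* c ℚ.* (a ℚ.* (m ℚ.* s)) ℚ.+ k ℚ.* m
      r₁ = solve 5 (λ k m a c s → k :* m :* (a :* c :* s :+ con 1ℚ) := k :* c :* (a :* (m :* s)) :+ k :* m) refl
        where open ℚSolver.+-*-Solver
      r₂ : ∀ a x y → a ℚ.* (x ℚ.* y) ≡ x ℚ.* (a ℚ.* y)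
      r₂ = solve 3 (λ a x y → a :* (x :* y) := x :* (a :* y)) refl
        where open ℚSolver.+-*-Solver

  module _ (a≥ : 1ℚ ℚ.≤ ι (2 ℕ.^ g) ℚ.* a) where

    d≤2^g : d ≤ 2 ℕ.^ g ℕ.* suc δ
    d≤2^g = ι-reflects-≤ (begin
      ι d                                   ≡⟨ sym (ℚₚ.*-identityʳ (ι d)) ⟩
      ι d ℚ.* 1ℚ                            ≤⟨ ℚₚ.*-monoˡ-≤-nonNeg (ι d) {{ι-nonNeg d}} a≥ ⟩
      ι d ℚ.* (ι (2 ℕ.^ g) ℚ.* a)           ≡⟨ r (ι d) (ι (2 ℕ.^ g)) a ⟩
      ι (2 ℕ.^ g) ℚ.* (a ℚ.* ι d)           ≤⟨ ℚₚ.*-monoˡ-≤-nonNeg (ι (2 ℕ.^ g)) {{ι-nonNeg (2 ℕ.^ g)}} aδ ⟩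
      ι (2 ℕ.^ g) ℚ.* (ι δ ℚ.+ ι 1)         ≡⟨ cong (ι (2 ℕ.^ g) ℚ.*_) (sym (ι-+ δ 1)) ⟩
      ι (2 ℕ.^ g) ℚ.* ι (δ ℕ.+ 1)           ≡⟨ sym (ι-* (2 ℕ.^ g) (δ ℕ.+ 1)) ⟩
      ι (2 ℕ.^ g ℕ.* (δ ℕ.+ 1))             ≡⟨ cong (λ x → ι (2 ℕ.^ g ℕ.* x)) (ℕₚ.+-comm δ 1) ⟩
      ι (2 ℕ.^ g ℕ.* (1 ℕ.+ δ))             ∎)
      where
      open ℚₚ.≤-Reasoning
      r : ∀ x y z → x ℚ.* (y ℚ.* z) ≡ y ℚ.* (z ℚ.* x)
      r = solve 3 (λ x y z → x :* (y :* z) := y :* (z :* x)) refl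
        where open ℚSolver.+-*-Solver

    8mq≤δ : 8 ℕ.* m ℕ.* 2 ℕ.^ J ≤ δ
    8mq≤δ = ℕ.s≤s⁻¹ (ℕₚ.*-cancelˡ-≤ (2 ℕ.^ g) {{ℕₚ.m^n≢0 2 g}} (ℕₚ.≤-trans 8mq≤ d≤2^g))

    128M≤δ : 128 ℕ.* M ≤ δ
    128M≤δ = ℕₚ.≤-trans 128M≤ 8mq≤δ

  -- After multiplication by 1000 the main term is 384 δ. The rest is at most 8384 M ≤ 66 * 128 M ≤
  -- 66 δ, and 384 + 66 = 450 is well below 1000.
  4Mt≤ : ∀ {t} → 128 ℕ.* M ≤ δ → 1000 ℕ.* M ℕ.* t ≤ 96 ℕ.* (δ ℕ.+ 1) ℕ.+ 1000 ℕ.* M → 4 ℕ.* M ℕ.* suc t ≤ δ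
  4Mt≤ {t} 128M≤δ le = ℕₚ.*-cancelˡ-≤ 1000 (begin
    1000 ℕ.* (4 ℕ.* M ℕ.* suc t)                          ≡⟨ r₁ M t ⟩
    4 ℕ.* (1000 ℕ.* M ℕ.* t) ℕ.+ 4000 ℕ.* M               ≤⟨ ℕₚ.+-monoˡ-≤ (4000 ℕ.* M) (ℕₚ.*-monoʳ-≤ 4 le) ⟩
    4 ℕ.* (96 ℕ.* (δ ℕ.+ 1) ℕ.+ 1000 ℕ.* M) ℕ.+ 4000 ℕ.* M ≡⟨ r₂ M δ ⟩
    384 ℕ.* δ ℕ.+ (384 ℕ.+ 8000 ℕ.* M)                    ≤⟨ ℕₚ.+-monoʳ-≤ (384 ℕ.* δ) (ℕₚ.+-monoˡ-≤ (8000 ℕ.* M) (ℕₚ.m≤m*n 384 M {{M≢0}})) ⟩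
    384 ℕ.* δ ℕ.+ (384 ℕ.* M ℕ.+ 8000 ℕ.* M)              ≤⟨ ℕₚ.m≤m+n _ (64 ℕ.* M) ⟩
    384 ℕ.* δ ℕ.+ (384 ℕ.* M ℕ.+ 8000 ℕ.* M) ℕ.+ 64 ℕ.* M ≡⟨ r₃ M δ ⟩
    384 ℕ.* δ ℕ.+ 66 ℕ.* (128 ℕ.* M)                      ≤⟨ ℕₚ.+-monoʳ-≤ (384 ℕ.* δ) (ℕₚ.*-monoʳ-≤ 66 128M≤δ) ⟩
    384 ℕ.* δ ℕ.+ 66 ℕ.* δ                                ≡⟨ sym (ℕₚ.*-distribʳ-+ δ 384 66) ⟩
    450 ℕ.* δ                                             ≤⟨ ℕₚ.*-monoˡ-≤ δ (ℕₚ.m≤m+n 450 550) ⟩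
    1000 ℕ.* δ                                            ∎)
    where
    open ℕₚ.≤-Reasoning
    r₁ : ∀ m t → 1000 ℕ.* (4 ℕ.* m ℕ.* suc t) ≡ 4 ℕ.* (1000 ℕ.* m ℕ.* t) ℕ.+ 4000 ℕ.* m
    r₁ = solve-∀
    r₂ : ∀ m d → 4 ℕ.* (96 ℕ.* (d ℕ.+ 1) ℕ.+ 1000 ℕ.* m) ℕ.+ 4000 ℕ.* m ≡ 384 ℕ.* d ℕ.+ (384 ℕ.+ 8000 ℕ.* m)
    r₂ = solve-∀
    r₃ : ∀ m d → 384 ℕ.* d ℕ.+ (384 ℕ.* m ℕ.+ 8000 ℕ.* m) ℕ.+ 64 ℕ.* m ≡ 384 ℕ.* d ℕ.+ 66 ℕ.* (128 ℕ.* m)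
    r₃ = solve-∀

_∩ᵉ_ : ∀ {P Q : ℕ → Set} → Eventually P → Eventually Q → Eventually (λ n → P n × Q n)
(k , p) ∩ᵉ (l , q) = k ℕ.⊔ l , λ n n≥ → p n (ℕₚ.m⊔n≤o⇒m≤o k l n≥) , q n (ℕₚ.m⊔n≤o⇒n≤o k l n≥)

theorem4p3 : (α : ℝ) → fromℕ 0 <ᴿ α → α ≤ᴿ fromℕ 1 →
    Σ[ d₀ ∈ ℕ ] (1 ≤ d₀ × (∀ (d : ℕ) → d₀ ≤ d →
    ∀ {n : ℕ} (G : Graph n) (δ : ℕ) →
    Bipartite G →
    IsMaxDegree G d →
    IsMinDegree G δ → α *ᴿ fromℕ d ≤ᴿ fromℕ δ →
    ∀ (ℓ s : ℝ) (k : ℤ) →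
    IsLog (fromℕ d) ℓ →
    IsSqrt (fromℕ d *ᴿ ℓ) s →
    IsFloor (α *ᴿ fromℚ (+ 1 / 1000) *ᴿ s) k →
    Removable G (λ v → + deg G v - k)))
theorem4p3 α (ε , ε>0 , α-positive) α≤1 = d₀ , ℕₚ.m^n>0 2 (16 ℕ.* (9 ℕ.+ g)) , holds
  where
  -- As ε eventually bounds the sequence of α from below and g ≤ 2 ^ g, this makes 2 ^ g α at least
  -- 1; it is fixed before d and G.
  g = proj₁ (archimedean ε ε>0)
  d₀ = 2 ℕ.^ (16 ℕ.* (9 ℕ.+ g))

  ε≥ : 1ℚ ℚ.≤ ι (2 ℕ.^ g) ℚ.* ε
  ε≥ = ℚₚ.≤-trans (proj₂ (archimedean ε ε>0)) (ℚₚ.*-monoʳ-≤-nonNeg ε {{ℚ.nonNegative (ℚₚ.<⇒≤ ε>0)}}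
    (ι-mono (ℕₚ.≤-trans (ℕₚ.n≤1+n g) (1+n≤2^n g))))

  holds : ∀ d → d₀ ≤ d → ∀ {n} (G : Graph n) δ → Bipartite G → IsMaxDegree G d → IsMinDegree G δ →
    α *ᴿ fromℕ d ≤ᴿ fromℕ δ → ∀ ℓ s k → IsLog (fromℕ d) ℓ → IsSqrt (fromℕ d *ᴿ ℓ) s →
    IsFloor (α *ᴿ fromℚ (+ 1 / 1000) *ᴿ s) k → Removable G (λ v → + deg G v - k)
  holds d d₀≤d G δ bip (deg≤ , _) (deg≥ , _) αd≤δ ℓ s k logℓ (_ , s²≤dℓ , _) (k≤ , _) = conclude k floor
    where
    P = parameters g d d₀≤d
    open Parameters P
    1≤d : 1 ≤ d
    1≤d = ℕₚ.≤-trans (ℕₚ.m^n>0 2 (16 ℕ.* (9 ℕ.+ g))) d₀≤d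
    -- All eventual inequalities are intersected so that they can be used at one common index.
    evidence = α-positive ∩ᵉ (αd≤δ 1ℚ 0<1 ∩ᵉ (s²≤dℓ 1ℚ 0<1 ∩ᵉ (k≤ 1ℚ 0<1 ∩ᵉ
      log≤ d (suc (16 ℕ.* suc J)) ℓ 1≤d (ℕₚ.*-monoʳ-≤ 2 d<) logℓ)))
    N₀ = proj₁ evidence
    at-N₀ = proj₂ evidence N₀ ℕₚ.≤-refl
    ε≤α : ε ℚ.≤ seq α N₀
    ε≤α = ℚₚ.≤-trans (ℚₚ.≤-reflexive (sym (ℚₚ.+-identityˡ ε))) (proj₁ at-N₀)
    floor : k / 1 ℚ.≤ seq α N₀ ℚ.* (+ 1 / 1000) ℚ.* seq s N₀ ℚ.+ 1ℚ
    floor = proj₁ (proj₂ (proj₂ (proj₂ at-N₀)))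
    open Index g d δ P 1≤d (seq α N₀) (seq s N₀) (seq ℓ N₀) (ℚₚ.≤-trans (ℚₚ.<⇒≤ ε>0) ε≤α)
      (proj₁ (proj₂ at-N₀)) (proj₁ (proj₂ (proj₂ at-N₀)))
    l≤ = proj₂ (proj₂ (proj₂ (proj₂ at-N₀)))
    α≥ : 1ℚ ℚ.≤ ι (2 ℕ.^ g) ℚ.* seq α N₀
    α≥ = ℚₚ.≤-trans ε≥ (ℚₚ.*-monoˡ-≤-nonNeg (ι (2 ℕ.^ g)) {{ι-nonNeg (2 ℕ.^ g)}} ε≤α)
    done-with : ∀ t → 4 ℕ.* M ℕ.* suc t ≤ δ → ∀ k → k ℤ.≤ + t → Removable G (λ v → + deg G v - k)
    done-with t 4Mt≤δ = removable G d δ t (2 ℕ.^ J) M J {{M≢0}} {{ℕ.>-nonZero 1≤d}} bip deg≤ deg≥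
      4Mt≤δ M²I≥ 2^I≤M (8mq≤δ α≥) room
    conclude : ∀ k → k / 1 ℚ.≤ seq α N₀ ℚ.* (+ 1 / 1000) ℚ.* seq s N₀ ℚ.+ 1ℚ → Removable G (λ v → + deg G v - k)
    conclude (+ t)    t≤ = done-with t (4Mt≤ (128M≤δ α≥) (1000Mt≤ l≤ t t≤)) (+ t) ℤₚ.≤-refl
    -- A negative k is below t = 0, for which 4 M ≤ 128 M ≤ δ suffices.
    conclude -[1+ t ] _  = done-with 0 (ℕₚ.≤-trans (ℕₚ.≤-reflexive (ℕₚ.*-identityʳ (4 ℕ.* M)))
      (ℕₚ.≤-trans (ℕₚ.*-monoˡ-≤ M (ℕₚ.m≤m+n 4 124)) (128M≤δ α≥))) -[1+ t ] ℤ.-≤+
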